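{- Let $p$ be an odd prime and $r$ a positive integer. Then $$\sum_{n=0}^{p^r-1}\frac{\left(\frac12\right)_n\left(\frac12\right)_{2n}}{n!^3}\,(20n+3)\,\frac{(-1)^n}{2^{4n}}\equiv 3(-1)^{(p^r-1)/2}p^r\pmod{p^{r+2}}.$$
   Context: $(a)_n=a(a+1)\cdots(a+n-1)$ for $n\ge1$ and $(a)_0=1$ is the rising factorial. A congruence $x\equiv y\pmod{p^m}$ between rational numbers means that the $p$-adic valuation of $x-y$ is at least $m$. -}

module Defs where

open import Data.Integer.Base as ℤ using (ℤ; +_; +0; 1ℤ; -1ℤ)
open import Data.Nat.Base as ℕ using (ℕ; zero; suc; _!)
open import Data.Nat.Divisibility using (_∣?_)
open import Data.Nat.Properties using (m^n≢0; _!≢0)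
open import Data.Rational.Base using (ℚ; 1ℚ; ½; ↥_; ↧ₙ_; _+_; _*_; _-_; _/_)
open import Relation.Nullary.Construct.Add.Supremum using (_⁺; [_]; ⊤⁺)
open import Relation.Binary.Construct.Add.Supremum.NonStrict ℤ._≤_ using (_≤⁺_)
open import Relation.Nullary.Decidable.Core using (yes; no)

rising : ℚ → ℕ → ℚ
rising a zero    = 1ℚ
rising a (suc n) = rising a n * (a + (+ n) / 1)

-- The greatest e ≤ k with p ^ e ∣ n.
multiplicity≤ : (k p n : ℕ) → ℕ
multiplicity≤ zero    p n = zero
multiplicity≤ (suc k) p n with p ℕ.^ suc k ∣? n
... | yes _ = suc k
... | no  _ = multiplicity≤ k p n

-- The exponent of p in n, for p ≥ 2 and n ≥ 1: the bound n loses nothing,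
-- since p ^ e ∣ n forces e < p ^ e ≤ n.
multiplicity : (p n : ℕ) → ℕ
multiplicity p n = multiplicity≤ n p n

-- The p-adic valuation (p prime), with ⊤⁺ = ∞ the valuation of 0.
valuation : ℕ → ℚ → ℤ ⁺
valuation p x with ↥ x
... | +0 = ⊤⁺
... | a  = [ + multiplicity p ℤ.∣ a ∣ ℤ.- + multiplicity p (↧ₙ x) ]

infix 4 _≋_[mod_^_]

_≋_[mod_^_] : ℚ → ℚ → (p m : ℕ) → Set
x ≋ y [mod p ^ m ] = [ + m ] ≤⁺ valuation p (x - y)

summand : ℕ → ℚ
summand n =
  rising ½ n * rising ½ (2 ℕ.* n) * (1ℤ / ((n !) ℕ.^ 3))
    * ((+ (20 ℕ.* n ℕ.+ 3)) / 1)
    * ((-1ℤ ℤ.^ n) / (2 ℕ.^ (4 ℕ.* n)))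
  where instance
    n!^3≢0 : ℕ.NonZero ((n !) ℕ.^ 3)
    n!^3≢0 = m^n≢0 (n !) 3 {{n !≢0}}

    2^4n≢0 : ℕ.NonZero (2 ℕ.^ (4 ℕ.* n))
    2^4n≢0 = m^n≢0 2 (4 ℕ.* n)

module Submission where

-- Let N = p ^ r = 2 K + 1 (N is ν in ℚ).  A Wilf–Zeilberger pair (F , G) with F n 0 = summand n
-- rewrites the sum as F K K plus the terms F n K (K < n < N) and G N k (k < K).
-- Because ½ + i = N / 2 - (K - i), rising factorials of ½ agree with quotients of
-- factorials up to factors 1 + c N / j (0 < j < N), and N / j ∈ p ℤ₍ₚ₎.  This shows
-- that the terms F n K and G N k are p-integral multiples of N (N B) (N B′), where
-- B and B′ are values m! l! / (m + l + 1)! with m + l + 1 < N.  The recursion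
-- B (m , l + 1) = B (m , l) - B (m + 1 , l) reduces N B ∈ p ℤ₍ₚ₎ to B (m , 0) = 1 / (m + 1).
-- Finally 4 ^ -K is a quotient of two such products, which gives
-- F K K = 3 (-1)ᴷ N ∏ⱼ (1 + x) (1 - 3 x) (1 - x)² / (1 - 2 x)² with x = N / 2 j, j ≤ K,
-- and each factor of the product is 1 modulo p².

open import Defs
open import Data.Empty using (⊥-elim)
open import Data.Fin.Base using (toℕ)
open import Data.Integer.Base as ℤ using (ℤ; +_; +0; +[1+_]; -[1+_]; 1ℤ; -1ℤ)
import Data.Integer.Divisibility.Signed as ℤ∣
import Data.Integer.Properties as ℤₚ
open import Data.Nat.Base as ℕ using (ℕ; zero; suc; _!; _≤_; _<_; s≤s; z≤n)
open import Data.Nat.Coprimality as Coprimality using (Coprime)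
open import Data.Nat.Divisibility
  using (_∣_; _∤_; _∣?_; divides; divides-refl; ∣-refl; ∣-trans; ∣-reflexive; ∣⇒≤; ∣1⇒≡1; _∣0; 1∣_;
         m∣m*n; *-monoʳ-∣; m%n≡0⇒n∣m)
open import Data.Nat.DivMod using (m*n/n≡m; m≡m%n+[m/n]*n; m%n<n)
open import Data.Nat.Primality using (Prime; prime[2]; euclidsLemma; prime⇒nonZero; prime⇒nonTrivial)
import Data.Nat.Properties as ℕₚ
import Data.Nat.Tactic.RingSolver as ℕ-Solver
open import Data.Product.Base using (∃; _×_; _,_; proj₁; proj₂)
open import Data.Rational.Base
  using (ℚ; mkℚ; 0ℚ; 1ℚ; ½; ↥_; ↧_; ↧ₙ_; _+_; _*_; _-_; -_; _/_; 1/_; NonZero; ≢-nonZero; fromℚᵘ)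
open import Data.Rational.Properties
  using (_≟_; +-*-commutativeRing; +-0-commutativeMonoid; toℚᵘ-injective; toℚᵘ-fromℚᵘ; toℚᵘ-homo-+;
         toℚᵘ-homo-*; fromℚᵘ-cong; ↥p/↧p≡p; *-comm; *-assoc; *-identityˡ; *-identityʳ; *-inverseˡ;
         *-inverseʳ; *-zeroˡ; *-zeroʳ; +-identityˡ; +-identityʳ; +-assoc; +-comm)
open import Algebra.Properties.CommutativeMonoid.Sum +-0-commutativeMonoid using (sum-syntax)
import Data.Rational.Unnormalised.Base as ℚᵘ
import Data.Rational.Unnormalised.Properties as ℚᵘₚ
open import Data.Sum.Base using (inj₁; inj₂; [_,_]′)
open import Relation.Binary.Construct.Add.Supremum.NonStrict ℤ._≤_ using (_≤⁺_; [_]; _≤⊤⁺)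
open import Relation.Binary.PropositionalEquality
  using (_≡_; refl; sym; trans; cong; cong₂; subst; subst₂; module ≡-Reasoning)
open import Relation.Nullary.Construct.Add.Supremum using ([_])
open import Relation.Nullary.Decidable using (dec⇒maybe; yes; no)
open import Relation.Nullary.Negation using (contradiction)
open import Tactic.RingSolver using (solve-∀)
open import Tactic.RingSolver.Core.AlmostCommutativeRing using (AlmostCommutativeRing; fromCommutativeRing)

open ≡-Reasoning

-- Integers inside ℚ

-- The sum truncates Ramanujan's series for 8/π, since (½)₂ₙ = 4ⁿ (¼)ₙ (¾)ₙ. The argument k of the
-- pair stops at K because (½)_k then still avoids the factor ½ + K = N / 2, which would put N into
-- a denominator; at k = K the factor 1 / (n - k)! also removes all n < K. In each of the other
-- terms (½)ₙ contains N / 2, and (½)_{2n+k} contains N / 2 and 3 N / 2: three factors N. The term F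
-- K K has only one of them, so it alone survives modulo p ^ (r + 2). The obstacle is r > 1:
-- factorials and rising factorials below N may be divisible by p themselves, and following the
-- valuation of each would be laborious. Therefore no valuation of a factorial is ever computed.
-- Each rising factorial or reciprocal is replaced by a quotient of factorials up to a p-integral
-- factor, after which the factorials cancel and only beta values (and a Catalan number) remain.

ℚ-ring : AlmostCommutativeRing _ _
ℚ-ring = fromCommutativeRing +-*-commutativeRing (λ x → dec⇒maybe (0ℚ ≟ x))

⟦_⟧ : ℤ → ℚ
⟦ z ⟧ = z / 1

ι : ℕ → ℚ
ι n = ⟦ + n ⟧

fromℚᵘ-homo-+ : ∀ x y → fromℚᵘ (x ℚᵘ.+ y) ≡ fromℚᵘ x + fromℚᵘ y
fromℚᵘ-homo-+ x y = toℚᵘ-injective (ℚᵘₚ.≃-trans (toℚᵘ-fromℚᵘ (x ℚᵘ.+ y))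
  (ℚᵘₚ.≃-sym (ℚᵘₚ.≃-trans (toℚᵘ-homo-+ (fromℚᵘ x) (fromℚᵘ y))
    (ℚᵘₚ.+-cong (toℚᵘ-fromℚᵘ x) (toℚᵘ-fromℚᵘ y)))))

fromℚᵘ-homo-* : ∀ x y → fromℚᵘ (x ℚᵘ.* y) ≡ fromℚᵘ x * fromℚᵘ y
fromℚᵘ-homo-* x y = toℚᵘ-injective (ℚᵘₚ.≃-trans (toℚᵘ-fromℚᵘ (x ℚᵘ.* y))
  (ℚᵘₚ.≃-sym (ℚᵘₚ.≃-trans (toℚᵘ-homo-* (fromℚᵘ x) (fromℚᵘ y))
    (ℚᵘₚ.*-cong (toℚᵘ-fromℚᵘ x) (toℚᵘ-fromℚᵘ y)))))

⟦⟧-+ : ∀ a b → ⟦ a ℤ.+ b ⟧ ≡ ⟦ a ⟧ + ⟦ b ⟧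
⟦⟧-+ a b = trans
  (cong ⟦_⟧ (sym (cong₂ ℤ._+_ (ℤₚ.*-identityʳ a) (ℤₚ.*-identityʳ b))))
  (fromℚᵘ-homo-+ (ℚᵘ.mkℚᵘ a 0) (ℚᵘ.mkℚᵘ b 0))

⟦⟧-* : ∀ a b → ⟦ a ℤ.* b ⟧ ≡ ⟦ a ⟧ * ⟦ b ⟧
⟦⟧-* a b = fromℚᵘ-homo-* (ℚᵘ.mkℚᵘ a 0) (ℚᵘ.mkℚᵘ b 0)

⟦⟧-injective : ∀ {a b} → ⟦ a ⟧ ≡ ⟦ b ⟧ → a ≡ b
⟦⟧-injective {a} {b} eq = trans (sym (↥⟦⟧ a)) (trans (cong ↥_ eq) (↥⟦⟧ b))
  where
  ↥⟦⟧ : ∀ z → ↥ ⟦ z ⟧ ≡ z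
  ↥⟦⟧ z = cong ↥_ (↥p/↧p≡p (mkℚ z 0 (Coprimality.sym (Coprimality.1-coprimeTo ℤ.∣ z ∣))))

ι-+ : ∀ m n → ι (m ℕ.+ n) ≡ ι m + ι n
ι-+ m n = ⟦⟧-+ (+ m) (+ n)

ι-* : ∀ m n → ι (m ℕ.* n) ≡ ι m * ι n
ι-* m n = trans (cong ⟦_⟧ (ℤₚ.pos-* m n)) (⟦⟧-* (+ m) (+ n))

ι-suc : ∀ n → ι (suc n) ≡ 1ℚ + ι n
ι-suc = ι-+ 1

/≡* : ∀ a n .{{_ : ℕ.NonZero n}} → a / n ≡ ⟦ a ⟧ * (1ℤ / n)
/≡* a n@(suc n-1) = trans
  (fromℚᵘ-cong {ℚᵘ.mkℚᵘ a n-1} {ℚᵘ.mkℚᵘ a 0 ℚᵘ.* ℚᵘ.mkℚᵘ 1ℤ n-1}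
    (ℚᵘ.*≡* (cong₂ ℤ._*_ (sym (ℤₚ.*-identityʳ a)) (cong +_ (ℕₚ.*-identityˡ n)))))
  (fromℚᵘ-homo-* (ℚᵘ.mkℚᵘ a 0) (ℚᵘ.mkℚᵘ 1ℤ n-1))

ι*1/ : ∀ n .{{_ : ℕ.NonZero n}} → ι n * (1ℤ / n) ≡ 1ℚ
ι*1/ n@(suc n-1) = trans (sym (/≡* (+ n) n))
  (fromℚᵘ-cong {ℚᵘ.mkℚᵘ (+ n) n-1} {ℚᵘ.1ℚᵘ} (ℚᵘ.*≡* (ℤₚ.*-comm (+ n) 1ℤ)))

*⟦↧⟧ : ∀ x → x * ⟦ ↧ x ⟧ ≡ ⟦ ↥ x ⟧
*⟦↧⟧ x = begin
  x * ι d                   ≡⟨ cong (_* ι d) (trans (sym (↥p/↧p≡p x)) (/≡* (↥ x) d)) ⟩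
  ⟦ ↥ x ⟧ * (1ℤ / d) * ι d   ≡⟨ ring ⟦ ↥ x ⟧ (1ℤ / d) (ι d) ⟩
  ⟦ ↥ x ⟧ * (ι d * (1ℤ / d)) ≡⟨ cong (⟦ ↥ x ⟧ *_) (ι*1/ d) ⟩
  ⟦ ↥ x ⟧ * 1ℚ               ≡⟨ *-identityʳ _ ⟩
  ⟦ ↥ x ⟧ ∎
  where
  d = ↧ₙ x
  ring : ∀ a b c → a * b * c ≡ a * (c * b)
  ring = solve-∀ ℚ-ring

↥-↧-coprime : ∀ x → Coprime ℤ.∣ ↥ x ∣ (↧ₙ x)
↥-↧-coprime (mkℚ _ _ coprime) = Coprimality.recompute coprime

-- Closed forms of reciprocals such as `1/fact` and `1/rising½` are proved by multiplying back to 1,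
-- so that every computation stays inside a commutative ring.
inverse-unique : ∀ {x y z} → x * y ≡ 1ℚ → x * z ≡ 1ℚ → y ≡ z
inverse-unique {x} {y} {z} xy xz = begin
  y           ≡⟨ *-identityʳ y ⟨
  y * 1ℚ      ≡⟨ cong (y *_) xz ⟨
  y * (x * z) ≡⟨ ring x y z ⟩
  x * y * z   ≡⟨ cong (_* z) xy ⟩
  1ℚ * z      ≡⟨ *-identityˡ z ⟩
  z ∎
  where
  ring : ∀ x y z → y * (x * z) ≡ x * y * z
  ring = solve-∀ ℚ-ring

-- The filtration of ℚ by p ^ m ℤ₍ₚ₎

multiplicity≤-greatest : ∀ {p n} e k → e ≤ k → p ℕ.^ e ∣ n → e ≤ multiplicity≤ k p n
multiplicity≤-greatest zero zero e≤k p^e∣n = z≤n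
multiplicity≤-greatest {p} {n} e (suc k) e≤k p^e∣n with p ℕ.^ suc k ∣? n
... | yes _ = e≤k
... | no p^k∤n with ℕₚ.m≤n⇒m<n∨m≡n e≤k
...   | inj₁ (s≤s e≤k-1) = multiplicity≤-greatest e k e≤k-1 p^e∣n
...   | inj₂ refl        = contradiction p^e∣n p^k∤n

multiplicity≤-∤ : ∀ {p n} k → p ∤ n → multiplicity≤ k p n ≡ 0
multiplicity≤-∤ zero p∤n = refl
multiplicity≤-∤ {p} {n} (suc k) p∤n with p ℕ.^ suc k ∣? n
... | yes p^k∣n = contradiction (∣-trans (m∣m*n (p ℕ.^ k)) p^k∣n) p∤n
... | no  _     = multiplicity≤-∤ k p∤n

m<n^m : ∀ {n} m → 1 < n → m < n ℕ.^ m
m<n^m zero    1<n = s≤s z≤n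
m<n^m {n} (suc m) 1<n = ℕₚ.≤-<-trans (m<n^m m 1<n) (ℕₚ.^-monoʳ-< n 1<n (ℕₚ.n<1+n m))

module Localization (p : ℕ) (p-prime : Prime p) where

  instance
    p≢0 : ℕ.NonZero p
    p≢0 = prime⇒nonZero p-prime

  1<p : 1 < p
  1<p = ℕ.nonTrivial⇒n>1 p {{prime⇒nonTrivial p-prime}}

  p∤* : ∀ a b → p ∤ a → p ∤ b → p ∤ a ℕ.* b
  p∤* a b p∤a p∤b p∣ab = [ p∤a , p∤b ]′ (euclidsLemma a b p-prime p∣ab)

  p∤1 : p ∤ 1
  p∤1 p∣1 = ℕₚ.<⇒≢ 1<p (sym (∣1⇒≡1 p∣1))

  π^ : ℕ → ℚ
  π^ m = ι (p ℕ.^ m)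

  π^-+ : ∀ m n → π^ (m ℕ.+ n) ≡ π^ m * π^ n
  π^-+ m n = trans (cong ι (ℕₚ.^-distribˡ-+-* p m n)) (ι-* (p ℕ.^ m) (p ℕ.^ n))

  -- x ∈ p ^ m ℤ₍ₚ₎
  record Div (m : ℕ) (x : ℚ) : Set where
    constructor div
    field
      den   : ℤ
      num   : ℤ
      p∤den : p ∤ ℤ.∣ den ∣
      eq    : x * ⟦ den ⟧ ≡ π^ m * ⟦ num ⟧

  Div-⟦⟧ : ∀ z → Div 0 ⟦ z ⟧
  Div-⟦⟧ z = div 1ℤ z p∤1 (*-comm ⟦ z ⟧ 1ℚ)

  Div-ι : ∀ n → Div 0 (ι n)
  Div-ι n = Div-⟦⟧ (+ n)

  Div-0 : ∀ {m} → Div m 0ℚ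
  Div-0 {m} = div 1ℤ +0 p∤1 (sym (*-zeroʳ (π^ m)))

  Div-π^ : ∀ m → Div m (π^ m)
  Div-π^ m = div 1ℤ 1ℤ p∤1 refl

  Div-1/ : ∀ n .{{_ : ℕ.NonZero n}} → p ∤ n → Div 0 (1ℤ / n)
  Div-1/ n p∤n = div (+ n) 1ℤ p∤n (trans (*-comm (1ℤ / n) (ι n)) (ι*1/ n))

  Div-* : ∀ {m n x y} → Div m x → Div n y → Div (m ℕ.+ n) (x * y)
  Div-* {m} {n} {x} {y} (div d a p∤d xd) (div e b p∤e ye) =
    div (d ℤ.* e) (a ℤ.* b) (λ q → p∤* _ _ p∤d p∤e (subst (p ∣_) (ℤₚ.abs-* d e) q)) (begin
      x * y * ⟦ d ℤ.* e ⟧               ≡⟨ cong (x * y *_) (⟦⟧-* d e) ⟩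
      x * y * (⟦ d ⟧ * ⟦ e ⟧)           ≡⟨ ring x y ⟦ d ⟧ ⟦ e ⟧ ⟩
      x * ⟦ d ⟧ * (y * ⟦ e ⟧)           ≡⟨ cong₂ _*_ xd ye ⟩
      π^ m * ⟦ a ⟧ * (π^ n * ⟦ b ⟧)     ≡⟨ ring (π^ m) (π^ n) ⟦ a ⟧ ⟦ b ⟧ ⟨
      π^ m * π^ n * (⟦ a ⟧ * ⟦ b ⟧)     ≡⟨ cong₂ _*_ (π^-+ m n) (⟦⟧-* a b) ⟨
      π^ (m ℕ.+ n) * ⟦ a ℤ.* b ⟧        ∎)
    where
    ring : ∀ x y d e → x * y * (d * e) ≡ x * d * (y * e)
    ring = solve-∀ ℚ-ring

  Div-*ʳ : ∀ {m x z} → Div m x → Div 0 z → Div m (x * z)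
  Div-*ʳ {m} {x} {z} Dx Dz = subst (Div m) (*-comm z x) (Div-* Dz Dx)

  Div-+ : ∀ {m x y} → Div m x → Div m y → Div m (x + y)
  Div-+ {m} {x} {y} (div d a p∤d xd) (div e b p∤e ye) =
    div (d ℤ.* e) (a ℤ.* e ℤ.+ b ℤ.* d) (λ q → p∤* _ _ p∤d p∤e (subst (p ∣_) (ℤₚ.abs-* d e) q)) (begin
      (x + y) * ⟦ d ℤ.* e ⟧                             ≡⟨ cong ((x + y) *_) (⟦⟧-* d e) ⟩
      (x + y) * (⟦ d ⟧ * ⟦ e ⟧)                         ≡⟨ ring₁ x y ⟦ d ⟧ ⟦ e ⟧ ⟩
      x * ⟦ d ⟧ * ⟦ e ⟧ + y * ⟦ e ⟧ * ⟦ d ⟧             ≡⟨ cong₂ (λ u v → u * ⟦ e ⟧ + v * ⟦ d ⟧) xd ye ⟩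
      π^ m * ⟦ a ⟧ * ⟦ e ⟧ + π^ m * ⟦ b ⟧ * ⟦ d ⟧       ≡⟨ ring₂ (π^ m) ⟦ a ⟧ ⟦ e ⟧ ⟦ b ⟧ ⟦ d ⟧ ⟩
      π^ m * (⟦ a ⟧ * ⟦ e ⟧ + ⟦ b ⟧ * ⟦ d ⟧)            ≡⟨ cong (π^ m *_) (cong₂ _+_ (⟦⟧-* a e) (⟦⟧-* b d)) ⟨
      π^ m * (⟦ a ℤ.* e ⟧ + ⟦ b ℤ.* d ⟧)                ≡⟨ cong (π^ m *_) (⟦⟧-+ (a ℤ.* e) (b ℤ.* d)) ⟨
      π^ m * ⟦ a ℤ.* e ℤ.+ b ℤ.* d ⟧                    ∎)
    where
    ring₁ : ∀ x y d e → (x + y) * (d * e) ≡ x * d * e + y * e * d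
    ring₁ = solve-∀ ℚ-ring
    ring₂ : ∀ m a e b d → m * a * e + m * b * d ≡ m * (a * e + b * d)
    ring₂ = solve-∀ ℚ-ring

  Div-neg : ∀ {m x} → Div m x → Div m (- x)
  Div-neg {x = x} Dx = subst (Div _) (ring x) (Div-* (Div-⟦⟧ -1ℤ) Dx)
    where
    ring : ∀ x → ⟦ -1ℤ ⟧ * x ≡ - x
    ring = solve-∀ ℚ-ring

  Div-- : ∀ {m x y} → Div m x → Div m y → Div m (x - y)
  Div-- Dx Dy = Div-+ Dx (Div-neg Dy)

  Div-≤ : ∀ {m n x} → m ≤ n → Div n x → Div m x
  Div-≤ {m} {n} m≤n (div d a p∤d xd) = div d (+ p ℕ.^ o ℤ.* a) p∤d (trans xd (begin
    π^ n * ⟦ a ⟧                     ≡⟨ cong (λ k → π^ k * ⟦ a ⟧) (sym (ℕₚ.m+[n∸m]≡n m≤n)) ⟩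
    π^ (m ℕ.+ o) * ⟦ a ⟧             ≡⟨ cong (_* ⟦ a ⟧) (π^-+ m o) ⟩
    π^ m * π^ o * ⟦ a ⟧              ≡⟨ *-assoc (π^ m) (π^ o) ⟦ a ⟧ ⟩
    π^ m * (π^ o * ⟦ a ⟧)            ≡⟨ cong (π^ m *_) (⟦⟧-* (+ p ℕ.^ o) a) ⟨
    π^ m * ⟦ + p ℕ.^ o ℤ.* a ⟧       ∎))
    where o = n ℕ.∸ m

  -- 1 - x ∈ ℤ₍ₚ₎ˣ for x ∈ p ℤ₍ₚ₎
  inverse-1- : ∀ {x} → Div 1 x → ∃ λ w → Div 0 w × (1ℚ - x) * w ≡ 1ℚ
  inverse-1- {x} (div d a p∤d xd) = w , div e d p∤e we , (begin
      (1ℚ - x) * (⟦ d ⟧ * e⁻¹)              ≡⟨ ring x ⟦ d ⟧ e⁻¹ ⟩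
      (⟦ d ⟧ - x * ⟦ d ⟧) * e⁻¹             ≡⟨ cong (_* e⁻¹) (trans (cong (λ u → ⟦ d ⟧ - u) xd) ⟦e⟧) ⟩
      ⟦ e ⟧ * e⁻¹                           ≡⟨ *-inverseʳ ⟦ e ⟧ ⟩
      1ℚ ∎)
    where
    -- (1 - x) d = d - p a is again prime to p, so it can serve as the denominator of the inverse d
    -- / e.
    e = d ℤ.- + (p ℕ.^ 1) ℤ.* a
    ⟦e⟧ : ⟦ d ⟧ - π^ 1 * ⟦ a ⟧ ≡ ⟦ e ⟧
    ⟦e⟧ = begin
      ⟦ d ⟧ - π^ 1 * ⟦ a ⟧                           ≡⟨ cong (λ u → ⟦ d ⟧ - u) (⟦⟧-* (+ (p ℕ.^ 1)) a) ⟨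
      ⟦ d ⟧ - ⟦ + (p ℕ.^ 1) ℤ.* a ⟧                  ≡⟨ ring′ ⟦ d ⟧ ⟦ + (p ℕ.^ 1) ℤ.* a ⟧ ⟩
      ⟦ d ⟧ + ⟦ -1ℤ ⟧ * ⟦ + (p ℕ.^ 1) ℤ.* a ⟧        ≡⟨ cong (λ u → ⟦ d ⟧ + u) (⟦⟧-* -1ℤ (+ (p ℕ.^ 1) ℤ.* a)) ⟨
      ⟦ d ⟧ + ⟦ -1ℤ ℤ.* (+ (p ℕ.^ 1) ℤ.* a) ⟧        ≡⟨ cong (λ u → ⟦ d ⟧ + ⟦ u ⟧) (ℤₚ.-1*i≡-i (+ (p ℕ.^ 1) ℤ.* a)) ⟩
      ⟦ d ⟧ + ⟦ ℤ.- (+ (p ℕ.^ 1) ℤ.* a) ⟧            ≡⟨ ⟦⟧-+ d (ℤ.- (+ (p ℕ.^ 1) ℤ.* a)) ⟨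
      ⟦ e ⟧ ∎
      where
      ring′ : ∀ x y → x - y ≡ x + ⟦ -1ℤ ⟧ * y
      ring′ = solve-∀ ℚ-ring
    p∤e : p ∤ ℤ.∣ e ∣
    p∤e p∣e = p∤d (ℤ∣.∣⇒∣ᵤ {+ p} {d} (ℤ∣.∣m+n∣n⇒∣m {+ p} {d} {ℤ.- (+ (p ℕ.^ 1) ℤ.* a)}
      (ℤ∣.∣ᵤ⇒∣ {+ p} {e} p∣e)
      (ℤ∣.∣m⇒∣-m {+ p} {+ (p ℕ.^ 1) ℤ.* a}
        (ℤ∣.∣m⇒∣m*n {+ p} {+ (p ℕ.^ 1)} a (ℤ∣.∣ᵤ⇒∣ {+ p} {+ (p ℕ.^ 1)} (m∣m*n 1))))))
    instance
      ⟦e⟧≢0 : NonZero ⟦ e ⟧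
      ⟦e⟧≢0 = ≢-nonZero λ eq → p∤e (subst (λ z → p ∣ ℤ.∣ z ∣) (sym (⟦⟧-injective {e} {+0} eq)) (p ∣0))
    e⁻¹ = 1/ ⟦ e ⟧
    w = ⟦ d ⟧ * e⁻¹
    we : w * ⟦ e ⟧ ≡ π^ 0 * ⟦ d ⟧
    we = trans (*-assoc ⟦ d ⟧ e⁻¹ ⟦ e ⟧) (trans (cong (⟦ d ⟧ *_) (*-inverseˡ ⟦ e ⟧)) (*-comm ⟦ d ⟧ 1ℚ))
    ring : ∀ x d e → (1ℚ - x) * (d * e) ≡ (d - x * d) * e
    ring = solve-∀ ℚ-ring

  -- The search for the exponent of p in n stops at n, which cannot cut off m because m < p ^ m ≤ n.
  multiplicity-bound : ∀ {m} n d .{{_ : ℕ.NonZero n}} → p ℕ.^ m ∣ n → p ∤ d →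
                       + m ℤ.≤ + multiplicity p n ℤ.- + multiplicity p d
  multiplicity-bound {m} n d p^m∣n p∤d =
    subst (λ k → + m ℤ.≤ + multiplicity p n ℤ.- + k) (sym (multiplicity≤-∤ d p∤d))
      (subst (+ m ℤ.≤_) (sym (ℤₚ.+-identityʳ (+ multiplicity p n)))
        (ℤ.+≤+ (multiplicity≤-greatest m n
          (ℕₚ.<⇒≤ (ℕₚ.<-≤-trans (m<n^m m 1<p) (∣⇒≤ p^m∣n))) p^m∣n)))

  ≤⁺valuation : ∀ {m} x → p ℕ.^ m ∣ ℤ.∣ ↥ x ∣ → p ∤ ↧ₙ x → [ + m ] ≤⁺ valuation p x
  ≤⁺valuation {m} (mkℚ +0       d-1 _) p^m∣n p∤d = _ ≤⊤⁺
  ≤⁺valuation {m} (mkℚ +[1+ n ] d-1 _) p^m∣n p∤d = [ multiplicity-bound (suc n) (suc d-1) p^m∣n p∤d ]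
  ≤⁺valuation {m} (mkℚ -[1+ n ] d-1 _) p^m∣n p∤d = [ multiplicity-bound (suc n) (suc d-1) p^m∣n p∤d ]

  -- `Div` admits unreduced fractions, which makes sums and products easy, whereas `valuation` reads
  -- the reduced one. Cross-multiplying gives ↥x d = p ^ m a b with b = ↧x. As b is coprime to ↥x,
  -- it divides d, hence p ∤ b; and Euclid's lemma moves the powers of p one by one from ↥x d to ↥x.
  Div⇒≤⁺valuation : ∀ {m x} → Div m x → [ + m ] ≤⁺ valuation p x
  Div⇒≤⁺valuation {m} {x} (div d a p∤d xd) = ≤⁺valuation x p^m∣↥x p∤b
    where
    b = ↧ₙ x
    eqℤ : ↥ x ℤ.* d ≡ + (p ℕ.^ m) ℤ.* a ℤ.* + b
    eqℤ = ⟦⟧-injective (begin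
      ⟦ ↥ x ℤ.* d ⟧                         ≡⟨ ⟦⟧-* (↥ x) d ⟩
      ⟦ ↥ x ⟧ * ⟦ d ⟧                       ≡⟨ cong (_* ⟦ d ⟧) (*⟦↧⟧ x) ⟨
      x * ι b * ⟦ d ⟧                       ≡⟨ ring x (ι b) ⟦ d ⟧ ⟩
      x * ⟦ d ⟧ * ι b                       ≡⟨ cong (_* ι b) (trans xd (sym (⟦⟧-* (+ (p ℕ.^ m)) a))) ⟩
      ⟦ + (p ℕ.^ m) ℤ.* a ⟧ * ι b           ≡⟨ ⟦⟧-* (+ (p ℕ.^ m) ℤ.* a) (+ b) ⟨
      ⟦ + (p ℕ.^ m) ℤ.* a ℤ.* + b ⟧         ∎)
      where
      ring : ∀ x y z → x * y * z ≡ x * z * y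
      ring = solve-∀ ℚ-ring
    eqℕ : ℤ.∣ ↥ x ∣ ℕ.* ℤ.∣ d ∣ ≡ p ℕ.^ m ℕ.* ℤ.∣ a ∣ ℕ.* b
    eqℕ = begin
      ℤ.∣ ↥ x ∣ ℕ.* ℤ.∣ d ∣             ≡⟨ ℤₚ.abs-* (↥ x) d ⟨
      ℤ.∣ ↥ x ℤ.* d ∣                   ≡⟨ cong ℤ.∣_∣ eqℤ ⟩
      ℤ.∣ + (p ℕ.^ m) ℤ.* a ℤ.* + b ∣   ≡⟨ ℤₚ.abs-* (+ (p ℕ.^ m) ℤ.* a) (+ b) ⟩
      ℤ.∣ + (p ℕ.^ m) ℤ.* a ∣ ℕ.* b     ≡⟨ cong (ℕ._* b) (ℤₚ.abs-* (+ (p ℕ.^ m)) a) ⟩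
      p ℕ.^ m ℕ.* ℤ.∣ a ∣ ℕ.* b         ∎
    p∤b : p ∤ b
    p∤b p∣b = p∤d (∣-trans p∣b (Coprimality.coprime-divisor
      (Coprimality.sym (↥-↧-coprime x))
      (divides (p ℕ.^ m ℕ.* ℤ.∣ a ∣) eqℕ)))
    cancel : ∀ k n o → p ℕ.^ k ℕ.* o ≡ n ℕ.* ℤ.∣ d ∣ → p ℕ.^ k ∣ n
    cancel zero    n o eq = 1∣ n
    cancel (suc k) n o eq with euclidsLemma n ℤ.∣ d ∣ p-prime
      (∣-trans (m∣m*n (p ℕ.^ k ℕ.* o)) (∣-reflexive (trans (sym (ℕₚ.*-assoc p (p ℕ.^ k) o)) eq)))
    ... | inj₂ p∣d = contradiction p∣d p∤d
    ... | inj₁ (divides-refl q) = subst (p ℕ.^ suc k ∣_) (ℕₚ.*-comm p q) (*-monoʳ-∣ p (cancel k q o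
      (ℕₚ.*-cancelˡ-≡ _ _ p (begin
        p ℕ.* (p ℕ.^ k ℕ.* o)       ≡⟨ ℕₚ.*-assoc p (p ℕ.^ k) o ⟨
        p ℕ.^ suc k ℕ.* o           ≡⟨ eq ⟩
        q ℕ.* p ℕ.* ℤ.∣ d ∣         ≡⟨ cong (ℕ._* ℤ.∣ d ∣) (ℕₚ.*-comm q p) ⟩
        p ℕ.* q ℕ.* ℤ.∣ d ∣         ≡⟨ ℕₚ.*-assoc p q ℤ.∣ d ∣ ⟩
        p ℕ.* (q ℕ.* ℤ.∣ d ∣)       ∎))))
    p^m∣↥x : p ℕ.^ m ∣ ℤ.∣ ↥ x ∣
    p^m∣↥x = cancel m ℤ.∣ ↥ x ∣ (ℤ.∣ a ∣ ℕ.* b) (trans (sym (ℕₚ.*-assoc (p ℕ.^ m) ℤ.∣ a ∣ b)) (sym eqℕ))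

-- Rising factorials, factorials and their inverses

rising-+ : ∀ a m n → rising a (m ℕ.+ n) ≡ rising a m * rising (a + ι m) n
rising-+ a m zero    = trans (cong (rising a) (ℕₚ.+-identityʳ m)) (sym (*-identityʳ (rising a m)))
rising-+ a m (suc n) = begin
  rising a (m ℕ.+ suc n)                                ≡⟨ cong (rising a) (ℕₚ.+-suc m n) ⟩
  rising a (m ℕ.+ n) * (a + ι (m ℕ.+ n))                ≡⟨ cong₂ (λ x y → x * (a + y)) (rising-+ a m n) (ι-+ m n) ⟩
  rising a m * rising (a + ι m) n * (a + (ι m + ι n))   ≡⟨ ring (rising a m) (rising (a + ι m) n) a (ι m) (ι n) ⟩
  rising a m * (rising (a + ι m) n * (a + ι m + ι n))   ∎
  where
  ring : ∀ x y a m n → x * y * (a + (m + n)) ≡ x * (y * (a + m + n))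
  ring = solve-∀ ℚ-ring

rising-suc : ∀ a n → rising a (suc n) ≡ a * rising (a + 1ℚ) n
rising-suc a n = trans (rising-+ a 1 n) (cong (_* rising (a + 1ℚ) n) (ring a))
  where
  ring : ∀ a → 1ℚ * (a + 0ℚ) ≡ a
  ring = solve-∀ ℚ-ring

sgn : ℕ → ℚ
sgn zero    = 1ℚ
sgn (suc n) = - sgn n

sgn² : ∀ n → sgn n * sgn n ≡ 1ℚ
sgn² zero    = refl
sgn² (suc n) = trans (ring (sgn n)) (sgn² n)
  where
  ring : ∀ x → (- x) * (- x) ≡ x * x
  ring = solve-∀ ℚ-ring

⟦-1^⟧≡sgn : ∀ n → ⟦ -1ℤ ℤ.^ n ⟧ ≡ sgn n
⟦-1^⟧≡sgn zero    = refl
⟦-1^⟧≡sgn (suc n) = trans (⟦⟧-* -1ℤ (-1ℤ ℤ.^ n)) (trans (cong (⟦ -1ℤ ⟧ *_) (⟦-1^⟧≡sgn n)) (ring (sgn n)))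
  where
  ring : ∀ x → ⟦ -1ℤ ⟧ * x ≡ - x
  ring = solve-∀ ℚ-ring

-- Every factor changes sign and the order is reversed. At a = ½ + c ν this turns the half-integers
-- into integers shifted by a multiple of ν.
rising-reflect : ∀ a n → rising a n ≡ sgn n * rising (1ℚ - a - ι n) n
rising-reflect a zero    = refl
rising-reflect a (suc n) = begin
  rising a n * (a + ι n)                                      ≡⟨ cong (_* (a + ι n)) (rising-reflect a n) ⟩
  sgn n * rising (1ℚ - a - ι n) n * (a + ι n)                 ≡⟨ ring (sgn n) (rising (1ℚ - a - ι n) n) a (ι n) ⟩
  - sgn n * ((1ℚ - a - (1ℚ + ι n)) * rising (1ℚ - a - ι n) n) ≡⟨ cong (λ y → - sgn n * ((1ℚ - a - (1ℚ + ι n)) * rising y n)) (ring′ a (ι n)) ⟩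
  - sgn n * ((1ℚ - a - (1ℚ + ι n)) * rising (1ℚ - a - (1ℚ + ι n) + 1ℚ) n) ≡⟨ cong (- sgn n *_) (rising-suc (1ℚ - a - (1ℚ + ι n)) n) ⟨
  - sgn n * rising (1ℚ - a - (1ℚ + ι n)) (suc n)              ≡⟨ cong (λ y → - sgn n * rising (1ℚ - a - y) (suc n)) (ι-suc n) ⟨
  - sgn n * rising (1ℚ - a - ι (suc n)) (suc n)               ∎
  where
  ring : ∀ s r a n → s * r * (a + n) ≡ - s * ((1ℚ - a - (1ℚ + n)) * r)
  ring = solve-∀ ℚ-ring
  ring′ : ∀ a n → 1ℚ - a - n ≡ 1ℚ - a - (1ℚ + n) + 1ℚ
  ring′ = solve-∀ ℚ-ring

1/1+ : ℕ → ℚ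
1/1+ n = 1ℤ / suc n

1+*1/1+ : ∀ n → (1ℚ + ι n) * 1/1+ n ≡ 1ℚ
1+*1/1+ n = trans (cong (_* 1/1+ n) (sym (ι-suc n))) (ι*1/ (suc n))

fact : ℕ → ℚ
fact n = ι (n !)

fact-suc : ∀ n → fact (suc n) ≡ (1ℚ + ι n) * fact n
fact-suc n = trans (ι-* (suc n) (n !)) (cong (_* fact n) (ι-suc n))

fact≡rising : ∀ n → fact n ≡ rising 1ℚ n
fact≡rising zero    = refl
fact≡rising (suc n) = trans (fact-suc n)
  (trans (cong ((1ℚ + ι n) *_) (fact≡rising n)) (*-comm (1ℚ + ι n) (rising 1ℚ n)))

fact-+ : ∀ m n → fact (m ℕ.+ n) ≡ fact m * rising (1ℚ + ι m) n
fact-+ m n = trans (fact≡rising (m ℕ.+ n)) (trans (rising-+ 1ℚ m n)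
  (cong (_* rising (1ℚ + ι m) n) (sym (fact≡rising m))))

1/fact : ℕ → ℚ
1/fact zero    = 1ℚ
1/fact (suc n) = 1/fact n * 1/1+ n

fact*1/fact : ∀ n → fact n * 1/fact n ≡ 1ℚ
fact*1/fact zero    = refl
fact*1/fact (suc n) = begin
  fact (suc n) * (1/fact n * 1/1+ n)                  ≡⟨ cong (_* (1/fact n * 1/1+ n)) (fact-suc n) ⟩
  (1ℚ + ι n) * fact n * (1/fact n * 1/1+ n)           ≡⟨ ring (1ℚ + ι n) (fact n) (1/fact n) (1/1+ n) ⟩
  (1ℚ + ι n) * 1/1+ n * (fact n * 1/fact n)           ≡⟨ cong₂ _*_ (1+*1/1+ n) (fact*1/fact n) ⟩
  1ℚ ∎
  where
  ring : ∀ a b c d → a * b * (c * d) ≡ a * d * (b * c)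
  ring = solve-∀ ℚ-ring

-- Oriented towards the larger index: like `1/rising½-suc`, it expresses a reciprocal through the
-- next one times a polynomial, so that the telescoping identity involves no division.
1/fact-suc : ∀ n → 1/fact n ≡ 1/fact (suc n) * (1ℚ + ι n)
1/fact-suc n = begin
  1/fact n                          ≡⟨ *-identityʳ (1/fact n) ⟨
  1/fact n * 1ℚ                     ≡⟨ cong (1/fact n *_) (1+*1/1+ n) ⟨
  1/fact n * ((1ℚ + ι n) * 1/1+ n)  ≡⟨ ring (1/fact n) (1ℚ + ι n) (1/1+ n) ⟩
  1/fact n * 1/1+ n * (1ℚ + ι n)    ∎
  where
  ring : ∀ a b c → a * (b * c) ≡ a * c * b
  ring = solve-∀ ℚ-ring

1/rising½ : ℕ → ℚ
1/rising½ zero    = 1ℚ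
1/rising½ (suc n) = 1/rising½ n * (ι 2 * 1/1+ (n ℕ.+ n))

½+*2/1+2 : ∀ n → (½ + ι n) * (ι 2 * 1/1+ (n ℕ.+ n)) ≡ 1ℚ
½+*2/1+2 n = begin
  (½ + ι n) * (ι 2 * 1/1+ (n ℕ.+ n))    ≡⟨ ring (ι n) (1/1+ (n ℕ.+ n)) ⟩
  (1ℚ + (ι n + ι n)) * 1/1+ (n ℕ.+ n)   ≡⟨ cong (λ y → (1ℚ + y) * 1/1+ (n ℕ.+ n)) (ι-+ n n) ⟨
  (1ℚ + ι (n ℕ.+ n)) * 1/1+ (n ℕ.+ n)   ≡⟨ 1+*1/1+ (n ℕ.+ n) ⟩
  1ℚ ∎
  where
  ring : ∀ n y → (½ + n) * (ι 2 * y) ≡ (1ℚ + (n + n)) * y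
  ring = solve-∀ ℚ-ring

rising½*1/rising½ : ∀ n → rising ½ n * 1/rising½ n ≡ 1ℚ
rising½*1/rising½ zero    = refl
rising½*1/rising½ (suc n) = trans (ring (rising ½ n) (½ + ι n) (1/rising½ n) (ι 2 * 1/1+ (n ℕ.+ n)))
  (cong₂ _*_ (rising½*1/rising½ n) (½+*2/1+2 n))
  where
  ring : ∀ a b c d → a * b * (c * d) ≡ a * c * (b * d)
  ring = solve-∀ ℚ-ring

1/rising½-suc : ∀ n → 1/rising½ n ≡ 1/rising½ (suc n) * (½ + ι n)
1/rising½-suc n = begin
  1/rising½ n                                                ≡⟨ *-identityʳ _ ⟨
  1/rising½ n * 1ℚ                                           ≡⟨ cong (1/rising½ n *_) (½+*2/1+2 n) ⟨
  1/rising½ n * ((½ + ι n) * (ι 2 * 1/1+ (n ℕ.+ n)))         ≡⟨ ring (1/rising½ n) (½ + ι n) (ι 2 * 1/1+ (n ℕ.+ n)) ⟩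
  1/rising½ (suc n) * (½ + ι n) ∎
  where
  ring : ∀ a b c → a * (b * c) ≡ a * c * b
  ring = solve-∀ ℚ-ring

-- 1 / (n - k)!, with value 0 for n < k
1/fact- : ℕ → ℕ → ℚ
1/fact- n       zero    = 1/fact n
1/fact- zero    (suc k) = 0ℚ
1/fact- (suc n) (suc k) = 1/fact- n k

-- For n = k the factor n - k vanishes, and for n < k the convention makes both sides 0; this is
-- what makes the telescoping identity hold for all n and k.
1/fact--suc : ∀ n k → 1/fact- n (suc k) ≡ (ι n - ι k) * 1/fact- n k
1/fact--suc zero    zero    = refl
1/fact--suc zero    (suc k) = sym (*-zeroʳ (ι 0 - ι (suc k)))
1/fact--suc (suc n) zero    = begin
  1/fact n                              ≡⟨ 1/fact-suc n ⟩
  1/fact (suc n) * (1ℚ + ι n)           ≡⟨ cong (1/fact (suc n) *_) (ι-suc n) ⟨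
  1/fact (suc n) * ι (suc n)            ≡⟨ ring (1/fact (suc n)) (ι (suc n)) ⟩
  (ι (suc n) - ι 0) * 1/fact (suc n)    ∎
  where
  ring : ∀ a b → a * b ≡ (b - 0ℚ) * a
  ring = solve-∀ ℚ-ring
1/fact--suc (suc n) (suc k) = begin
  1/fact- n (suc k)                          ≡⟨ 1/fact--suc n k ⟩
  (ι n - ι k) * 1/fact- n k                  ≡⟨ cong (_* 1/fact- n k) (ring (ι n) (ι k)) ⟩
  (1ℚ + ι n - (1ℚ + ι k)) * 1/fact- n k      ≡⟨ cong₂ (λ x y → (x - y) * 1/fact- n k) (ι-suc n) (ι-suc k) ⟨
  (ι (suc n) - ι (suc k)) * 1/fact- n k      ∎
  where
  ring : ∀ a b → a - b ≡ 1ℚ + a - (1ℚ + b)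
  ring = solve-∀ ℚ-ring

1/fact--< : ∀ {n k} → n < k → 1/fact- n k ≡ 0ℚ
1/fact--< {zero}  (s≤s _)   = refl
1/fact--< {suc n} (s≤s n<k) = 1/fact--< n<k

1/fact--+ : ∀ k n → 1/fact- (k ℕ.+ n) k ≡ 1/fact n
1/fact--+ zero    n = refl
1/fact--+ (suc k) n = 1/fact--+ k n

1/4^ : ℕ → ℚ
1/4^ zero    = 1ℚ
1/4^ (suc n) = 1/4^ n * (1ℤ / 4)

1/16^ : ℕ → ℚ
1/16^ n = 1/4^ n * 1/4^ n

4^*1/4^ : ∀ n → ι (4 ℕ.^ n) * 1/4^ n ≡ 1ℚ
4^*1/4^ zero    = refl
4^*1/4^ (suc n) = begin
  ι (4 ℕ.* 4 ℕ.^ n) * (1/4^ n * (1ℤ / 4))      ≡⟨ cong (_* (1/4^ n * (1ℤ / 4))) (ι-* 4 (4 ℕ.^ n)) ⟩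
  ι 4 * ι (4 ℕ.^ n) * (1/4^ n * (1ℤ / 4))      ≡⟨ ring (ι (4 ℕ.^ n)) (1/4^ n) ⟩
  ι (4 ℕ.^ n) * 1/4^ n                         ≡⟨ 4^*1/4^ n ⟩
  1ℚ ∎
  where
  ring : ∀ a b → ι 4 * a * (b * (1ℤ / 4)) ≡ a * b
  ring = solve-∀ ℚ-ring

-- The two new factors 2n + 1 and 2n + 2, divided by 4, are ½ + n and 1 + n. For n = K this is the
-- source of the formula for 4 ^ -K.
fact-duplication : ∀ n → fact (n ℕ.+ n) * 1/4^ n ≡ fact n * rising ½ n
fact-duplication zero    = refl
fact-duplication (suc n) = begin
  fact (suc n ℕ.+ suc n) * 1/4^ (suc n)                                         ≡⟨ cong (_* 1/4^ (suc n)) fact-2+ ⟩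
  (1ℚ + (1ℚ + (ι n + ι n))) * ((1ℚ + (ι n + ι n)) * fact (n ℕ.+ n)) * (1/4^ n * (1ℤ / 4)) ≡⟨ ring (ι n) (fact (n ℕ.+ n)) (1/4^ n) ⟩
  (1ℚ + ι n) * (½ + ι n) * (fact (n ℕ.+ n) * 1/4^ n)                            ≡⟨ cong ((1ℚ + ι n) * (½ + ι n) *_) (fact-duplication n) ⟩
  (1ℚ + ι n) * (½ + ι n) * (fact n * rising ½ n)                                ≡⟨ ring′ (1ℚ + ι n) (½ + ι n) (fact n) (rising ½ n) ⟩
  (1ℚ + ι n) * fact n * rising ½ (suc n)                                        ≡⟨ cong (_* rising ½ (suc n)) (fact-suc n) ⟨
  fact (suc n) * rising ½ (suc n)                                               ∎
  where
  fact-2+ : fact (suc n ℕ.+ suc n) ≡ (1ℚ + (1ℚ + (ι n + ι n))) * ((1ℚ + (ι n + ι n)) * fact (n ℕ.+ n))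
  fact-2+ = begin
    fact (suc n ℕ.+ suc n)                                    ≡⟨ cong (λ k → fact (suc k)) (ℕₚ.+-suc n n) ⟩
    fact (suc (suc (n ℕ.+ n)))                                ≡⟨ fact-suc (suc (n ℕ.+ n)) ⟩
    (1ℚ + ι (suc (n ℕ.+ n))) * fact (suc (n ℕ.+ n))           ≡⟨ cong₂ (λ x y → (1ℚ + x) * y) (trans (ι-suc (n ℕ.+ n)) (cong (λ y → 1ℚ + y) (ι-+ n n))) (trans (fact-suc (n ℕ.+ n)) (cong (λ y → (1ℚ + y) * fact (n ℕ.+ n)) (ι-+ n n))) ⟩
    (1ℚ + (1ℚ + (ι n + ι n))) * ((1ℚ + (ι n + ι n)) * fact (n ℕ.+ n)) ∎
  ring : ∀ n f e → (1ℚ + (1ℚ + (n + n))) * ((1ℚ + (n + n)) * f) * (e * (1ℤ / 4)) ≡ (1ℚ + n) * (½ + n) * (f * e)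
  ring = solve-∀ ℚ-ring
  ring′ : ∀ a b c d → a * b * (c * d) ≡ a * c * (d * b)
  ring′ = solve-∀ ℚ-ring

sgn-+ : ∀ m n → sgn (m ℕ.+ n) ≡ sgn m * sgn n
sgn-+ zero    n = sym (*-identityˡ (sgn n))
sgn-+ (suc m) n = trans (cong -_ (sgn-+ m n)) (ring (sgn m) (sgn n))
  where
  ring : ∀ a b → - (a * b) ≡ - a * b
  ring = solve-∀ ℚ-ring

1/fact--refl : ∀ n → 1/fact- n n ≡ 1ℚ
1/fact--refl zero    = refl
1/fact--refl (suc n) = 1/fact--refl n

-- Binomial coefficients and Catalan numbers

binomial : ℕ → ℕ → ℚ
binomial m n = fact (m ℕ.+ n) * (1/fact m * 1/fact n)

binomial-suc : ∀ m n → binomial (suc m) (suc n) ≡ binomial m (suc n) + binomial (suc m) n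
binomial-suc m n = begin
  fact (suc m ℕ.+ suc n) * (1/fact (suc m) * 1/fact (suc n))
    ≡⟨ cong (_* (g * h)) (trans (fact-suc (m ℕ.+ suc n)) (cong (λ x → (1ℚ + x) * t) ι-sum)) ⟩
  (1ℚ + (ι m + (1ℚ + ι n))) * t * (g * h)
    ≡⟨ ring (ι m) (ι n) t g h ⟩
  t * (g * (1ℚ + ι m) * h) + t * (g * (h * (1ℚ + ι n)))
    ≡⟨ cong₂ (λ x y → t * (x * h) + t * (g * y)) (1/fact-suc m) (1/fact-suc n) ⟨
  t * (1/fact m * h) + t * (g * 1/fact n)
    ≡⟨ cong (λ k → t * (1/fact m * h) + fact k * (g * 1/fact n)) (ℕₚ.+-suc m n) ⟩
  binomial m (suc n) + binomial (suc m) n ∎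
  where
  t = fact (m ℕ.+ suc n)
  g = 1/fact (suc m)
  h = 1/fact (suc n)
  ι-sum : ι (m ℕ.+ suc n) ≡ ι m + (1ℚ + ι n)
  ι-sum = trans (ι-+ m (suc n)) (cong (λ x → ι m + x) (ι-suc n))
  ring : ∀ m n t g h → (1ℚ + (m + (1ℚ + n))) * t * (g * h) ≡ t * (g * (1ℚ + m) * h) + t * (g * (h * (1ℚ + n)))
  ring = solve-∀ ℚ-ring

catalan : ℕ → ℚ
catalan n = fact (n ℕ.+ n) * (1/fact n * 1/fact (suc n))

-- The ballot difference. It shows integrality even where p divides the n + 2 by which the central
-- binomial coefficient is divided; Pascal's rule does the same for the binomials.
catalan-binomial : ∀ n → catalan (suc n) ≡ binomial (suc n) (suc n) - binomial (suc (suc n)) n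
catalan-binomial n = begin
  t * (g * h)                                              ≡⟨ ring (ι n) t g h ⟩
  t * (g * (h * (1ℚ + (1ℚ + ι n)))) - t * (h * (g * (1ℚ + ι n)))
    ≡⟨ cong₂ (λ x y → t * (g * x) - t * (h * y))
         (trans (1/fact-suc (suc n)) (cong (λ x → h * (1ℚ + x)) (ι-suc n))) (1/fact-suc n) ⟨
  t * (g * g) - t * (h * 1/fact n)
    ≡⟨ cong (λ k → t * (g * g) - fact (suc k) * (h * 1/fact n)) (ℕₚ.+-suc n n) ⟩
  binomial (suc n) (suc n) - binomial (suc (suc n)) n ∎
  where
  t = fact (suc n ℕ.+ suc n)
  g = 1/fact (suc n)
  h = 1/fact (suc (suc n))
  ring : ∀ n t g h → t * (g * h) ≡ t * (g * (h * (1ℚ + (1ℚ + n)))) - t * (h * (g * (1ℚ + n)))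
  ring = solve-∀ ℚ-ring

-- The Wilf–Zeilberger pair

-- The factors are abstracted to variables, so that the ring solver meets signs, rising factorials
-- and reciprocals only as atoms.
F-term : (s R S n k e a f E : ℚ) → ℚ
F-term s R S n k e a f E =
  s * R * S * (ι 20 * n - ι 2 * k + ι 3) * (e * e) * a * (f * f) * (E * E)

G-term : (s R S n e a f E : ℚ) → ℚ
G-term s R S n e a f E = - ι 32 * s * R * S * (n * n) * (e * e) * a * (f * f) * (E * E)

F : ℕ → ℕ → ℚ
F n k = F-term (sgn (n ℕ.+ k)) (rising ½ n) (rising ½ (n ℕ.+ n ℕ.+ k)) (ι n) (ι k)
  (1/rising½ k) (1/fact- n k) (1/fact n) (1/4^ n)

G : ℕ → ℕ → ℚ
G n k = G-term (sgn (n ℕ.+ k)) (rising ½ n) (rising ½ (n ℕ.+ n ℕ.+ k)) (ι n)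
  (1/rising½ (suc k)) (1/fact- n (suc k)) (1/fact n) (1/4^ n)

F-term-cong : ∀ s R S n k e a f E {s′ R′ S′ n′ k′ e′ a′ f′ E′} →
  s ≡ s′ → R ≡ R′ → S ≡ S′ → n ≡ n′ → k ≡ k′ → e ≡ e′ → a ≡ a′ → f ≡ f′ → E ≡ E′ →
  F-term s R S n k e a f E ≡ F-term s′ R′ S′ n′ k′ e′ a′ f′ E′
F-term-cong _ _ _ _ _ _ _ _ _ refl refl refl refl refl refl refl refl refl = refl

G-term-cong : ∀ s R S n e a f E {s′ R′ S′ n′ e′ a′ f′ E′} →
  s ≡ s′ → R ≡ R′ → S ≡ S′ → n ≡ n′ → e ≡ e′ → a ≡ a′ → f ≡ f′ → E ≡ E′ →
  G-term s R S n e a f E ≡ G-term s′ R′ S′ n′ e′ a′ f′ E′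
G-term-cong _ _ _ _ _ _ _ _ refl refl refl refl refl refl refl refl = refl

-- The Wilf-Zeilberger equation. All four terms are written in the atoms (½)ₙ, (½)_{2n+k}, 1 /
-- (½)_{k+1}, 1 / (n - k)!, 1 / (n + 1)! and 4 ^ -n, that is, rising factorials of lowest index, and
-- 1 / (½)_k and 1 / n! raised to the next index. What is left is a polynomial identity.
F-G-telescope : ∀ n k → F n k ≡ F n (suc k) + (G (suc n) k - G n k)
F-G-telescope n k = begin
  F n k
    ≡⟨ F-term-cong s R S (ι n) (ι k) (1/rising½ k) a (1/fact n) E
         refl refl refl refl refl (1/rising½-suc k) refl (1/fact-suc n) refl ⟩
  F-term s R S (ι n) (ι k) (e * (½ + ι k)) a (f * (1ℚ + ι n)) E
    ≡⟨ ring s R S (ι n) (ι k) e a f E ⟩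
  F-term (- s) R (S * (½ + (ι n + ι n + ι k))) (ι n) (1ℚ + ι k) e ((ι n - ι k) * a) (f * (1ℚ + ι n)) E
    + (G-term (- s) (R * (½ + ι n)) (S * (½ + (ι n + ι n + ι k)) * (½ + (1ℚ + (ι n + ι n + ι k)))) (1ℚ + ι n) e a f (E * (1ℤ / 4))
      - G-term s R S (ι n) e ((ι n - ι k) * a) (f * (1ℚ + ι n)) E)
    ≡⟨ cong₂ _+_ F-suc (cong₂ _-_ G-suc G-same) ⟨
  F n (suc k) + (G (suc n) k - G n k) ∎
  where
  s = sgn (n ℕ.+ k)
  R = rising ½ n
  S = rising ½ (n ℕ.+ n ℕ.+ k)
  e = 1/rising½ (suc k)
  a = 1/fact- n k
  f = 1/fact (suc n)
  E = 1/4^ n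
  ι-2n+k : ι (n ℕ.+ n ℕ.+ k) ≡ ι n + ι n + ι k
  ι-2n+k = trans (ι-+ (n ℕ.+ n) k) (cong (_+ ι k) (ι-+ n n))
  S-suc : rising ½ (suc (n ℕ.+ n ℕ.+ k)) ≡ S * (½ + (ι n + ι n + ι k))
  S-suc = cong (λ x → S * (½ + x)) ι-2n+k
  F-suc : F n (suc k) ≡ F-term (- s) R (S * (½ + (ι n + ι n + ι k))) (ι n) (1ℚ + ι k) e ((ι n - ι k) * a) (f * (1ℚ + ι n)) E
  F-suc = F-term-cong (sgn (n ℕ.+ suc k)) R (rising ½ (n ℕ.+ n ℕ.+ suc k)) (ι n) (ι (suc k)) e (1/fact- n (suc k)) (1/fact n) E
    (cong sgn (ℕₚ.+-suc n k)) refl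
    (trans (cong (rising ½) (ℕₚ.+-suc (n ℕ.+ n) k)) S-suc)
    refl (ι-suc k) refl (1/fact--suc n k) (1/fact-suc n) refl
  G-suc : G (suc n) k ≡ G-term (- s) (R * (½ + ι n)) (S * (½ + (ι n + ι n + ι k)) * (½ + (1ℚ + (ι n + ι n + ι k)))) (1ℚ + ι n) e a f (E * (1ℤ / 4))
  G-suc = G-term-cong (- s) (R * (½ + ι n)) (rising ½ (suc n ℕ.+ suc n ℕ.+ k)) (ι (suc n)) e a f (E * (1ℤ / 4))
    refl refl
    (trans (cong (λ m → rising ½ (suc (m ℕ.+ k))) (ℕₚ.+-suc n n))
      (cong₂ (λ x y → x * (½ + y)) S-suc (trans (ι-suc (n ℕ.+ n ℕ.+ k)) (cong (λ x → 1ℚ + x) ι-2n+k))))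
    (ι-suc n) refl refl refl refl
  G-same : G n k ≡ G-term s R S (ι n) e ((ι n - ι k) * a) (f * (1ℚ + ι n)) E
  G-same = G-term-cong s R S (ι n) e (1/fact- n (suc k)) (1/fact n) E
    refl refl refl refl refl (1/fact--suc n k) (1/fact-suc n) refl
  ring : ∀ s R S n k e a f E →
    s * R * S * (ι 20 * n - ι 2 * k + ι 3)
      * (e * (½ + k) * (e * (½ + k))) * a * (f * (1ℚ + n) * (f * (1ℚ + n))) * (E * E)
    ≡ - s * R * (S * (½ + (n + n + k))) * (ι 20 * n - ι 2 * (1ℚ + k) + ι 3)
      * (e * e) * ((n - k) * a) * (f * (1ℚ + n) * (f * (1ℚ + n))) * (E * E)
    + (- ι 32 * - s * (R * (½ + n)) * (S * (½ + (n + n + k)) * (½ + (1ℚ + (n + n + k)))) * ((1ℚ + n) * (1ℚ + n))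
        * (e * e) * a * (f * f) * (E * (1ℤ / 4) * (E * (1ℤ / 4)))
      - - ι 32 * s * R * S * (n * n)
        * (e * e) * ((n - k) * a) * (f * (1ℚ + n) * (f * (1ℚ + n))) * (E * E))
  ring = solve-∀ ℚ-ring

-- The summand as F n 0

1/[n!^3] : ∀ n .{{_ : ℕ.NonZero ((n !) ℕ.^ 3)}} → 1ℤ / ((n !) ℕ.^ 3) ≡ 1/fact n * 1/fact n * 1/fact n
1/[n!^3] n = inverse-unique {ι ((n !) ℕ.^ 3)} (ι*1/ ((n !) ℕ.^ 3)) (begin
  ι ((n !) ℕ.^ 3) * (1/fact n * 1/fact n * 1/fact n)            ≡⟨ cong (_* (1/fact n * 1/fact n * 1/fact n)) cube ⟩
  fact n * (fact n * (fact n * 1ℚ)) * (1/fact n * 1/fact n * 1/fact n) ≡⟨ ring (fact n) (1/fact n) ⟩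
  fact n * 1/fact n * (fact n * 1/fact n) * (fact n * 1/fact n) ≡⟨ cong (λ x → x * x * x) (fact*1/fact n) ⟩
  1ℚ ∎)
  where
  cube : ι ((n !) ℕ.^ 3) ≡ fact n * (fact n * (fact n * 1ℚ))
  cube = trans (ι-* (n !) _) (cong (fact n *_) (trans (ι-* (n !) _) (cong (fact n *_) (ι-* (n !) 1))))
  ring : ∀ x y → x * (x * (x * 1ℚ)) * (y * y * y) ≡ x * y * (x * y) * (x * y)
  ring = solve-∀ ℚ-ring

1/[2^4n] : ∀ n .{{_ : ℕ.NonZero (2 ℕ.^ (4 ℕ.* n))}} → 1ℤ / (2 ℕ.^ (4 ℕ.* n)) ≡ 1/16^ n
1/[2^4n] n = inverse-unique {ι (2 ℕ.^ (4 ℕ.* n))} (ι*1/ (2 ℕ.^ (4 ℕ.* n))) (begin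
  ι (2 ℕ.^ (4 ℕ.* n)) * (1/4^ n * 1/4^ n)                    ≡⟨ cong (λ x → ι x * 1/16^ n) (trans (sym (ℕₚ.^-*-assoc 2 4 n)) (^-distribʳ-* n)) ⟩
  ι (4 ℕ.^ n ℕ.* 4 ℕ.^ n) * (1/4^ n * 1/4^ n)                ≡⟨ cong (_* 1/16^ n) (ι-* (4 ℕ.^ n) (4 ℕ.^ n)) ⟩
  ι (4 ℕ.^ n) * ι (4 ℕ.^ n) * (1/4^ n * 1/4^ n)              ≡⟨ ring (ι (4 ℕ.^ n)) (1/4^ n) ⟩
  ι (4 ℕ.^ n) * 1/4^ n * (ι (4 ℕ.^ n) * 1/4^ n)              ≡⟨ cong (λ x → x * x) (4^*1/4^ n) ⟩
  1ℚ ∎)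
  where
  ^-distribʳ-* : ∀ n → 16 ℕ.^ n ≡ 4 ℕ.^ n ℕ.* 4 ℕ.^ n
  ^-distribʳ-* zero    = refl
  ^-distribʳ-* (suc n) = trans (cong (16 ℕ.*_) (^-distribʳ-* n)) (ringℕ (4 ℕ.^ n))
    where
    ringℕ : ∀ x → 16 ℕ.* (x ℕ.* x) ≡ 4 ℕ.* x ℕ.* (4 ℕ.* x)
    ringℕ = ℕ-Solver.solve-∀
  ring : ∀ x y → x * x * (y * y) ≡ x * y * (x * y)
  ring = solve-∀ ℚ-ring

summand≡F : ∀ n → summand n ≡ F n 0
summand≡F n = begin
  summand n
    ≡⟨ cong-* (rising ½ n) (cong (λ m → rising ½ (n ℕ.+ m)) (ℕₚ.+-identityʳ n))
         (1/[n!^3] n {{ℕₚ.m^n≢0 (n !) 3 {{n ℕₚ.!≢0}}}})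
         (trans (ι-+ (20 ℕ.* n) 3) (cong (_+ ι 3) (ι-* 20 n)))
         (trans (/≡* (-1ℤ ℤ.^ n) (2 ℕ.^ (4 ℕ.* n)) {{ℕₚ.m^n≢0 2 (4 ℕ.* n)}})
           (cong₂ _*_ (⟦-1^⟧≡sgn n) (1/[2^4n] n {{ℕₚ.m^n≢0 2 (4 ℕ.* n)}}))) ⟩
  rising ½ n * rising ½ (n ℕ.+ n) * (1/fact n * 1/fact n * 1/fact n) * (ι 20 * ι n + ι 3) * (sgn n * 1/16^ n)
    ≡⟨ ring (sgn n) (rising ½ n) (rising ½ (n ℕ.+ n)) (ι n) (1/fact n) (1/4^ n) ⟩
  F-term (sgn n) (rising ½ n) (rising ½ (n ℕ.+ n)) (ι n) (ι 0) 1ℚ (1/fact n) (1/fact n) (1/4^ n)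
    ≡⟨ F-term-cong (sgn (n ℕ.+ 0)) (rising ½ n) (rising ½ (n ℕ.+ n ℕ.+ 0)) (ι n) (ι 0) 1ℚ (1/fact n) (1/fact n) (1/4^ n)
         (cong sgn (ℕₚ.+-identityʳ n)) refl (cong (rising ½) (ℕₚ.+-identityʳ (n ℕ.+ n)))
         refl refl refl refl refl refl ⟨
  F n 0 ∎
  where
  cong-* : ∀ R {S S′ A A′ B B′ C C′} → S ≡ S′ → A ≡ A′ → B ≡ B′ → C ≡ C′ →
          R * S * A * B * C ≡ R * S′ * A′ * B′ * C′
  cong-* _ refl refl refl refl = refl
  ring : ∀ s R S n f E →
    R * S * (f * f * f) * (ι 20 * n + ι 3) * (s * (E * E))
    ≡ s * R * S * (ι 20 * n - ι 2 * ι 0 + ι 3) * (1ℚ * 1ℚ) * f * (f * f) * (E * E)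
  ring = solve-∀ ℚ-ring

-- Finite sums and telescoping

Σ< : ℕ → (ℕ → ℚ) → ℚ
Σ< zero    f = 0ℚ
Σ< (suc n) f = Σ< n f + f n

Σ<-suc : ∀ n f → Σ< (suc n) f ≡ f 0 + Σ< n (λ i → f (suc i))
Σ<-suc zero    f = +-comm 0ℚ (f 0)
Σ<-suc (suc n) f = trans (cong (_+ f (suc n)) (Σ<-suc n f)) (+-assoc (f 0) _ _)

∑≡Σ< : ∀ n f → (∑[ i < n ] f (toℕ i)) ≡ Σ< n f
∑≡Σ< zero    f = refl
∑≡Σ< (suc n) f = trans (cong (λ x → f 0 + x) (∑≡Σ< n (λ i → f (suc i)))) (sym (Σ<-suc n f))

Σ<-cong : ∀ n {f g} → (∀ i → f i ≡ g i) → Σ< n f ≡ Σ< n g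
Σ<-cong zero    eq = refl
Σ<-cong (suc n) eq = cong₂ _+_ (Σ<-cong n eq) (eq n)

Σ<-+ : ∀ m n f → Σ< (m ℕ.+ n) f ≡ Σ< m f + Σ< n (λ i → f (m ℕ.+ i))
Σ<-+ m zero    f = trans (cong (λ k → Σ< k f) (ℕₚ.+-identityʳ m)) (sym (+-identityʳ (Σ< m f)))
Σ<-+ m (suc n) f = trans (cong (λ k → Σ< k f) (ℕₚ.+-suc m n))
  (trans (cong (_+ f (m ℕ.+ n)) (Σ<-+ m n f)) (+-assoc (Σ< m f) _ _))

Σ<-zero : ∀ n {f} → (∀ i → i < n → f i ≡ 0ℚ) → Σ< n f ≡ 0ℚ
Σ<-zero zero    eq = refl
Σ<-zero (suc n) eq = cong₂ _+_ (Σ<-zero n (λ i i<n → eq i (ℕₚ.m<n⇒m<1+n i<n))) (eq n (ℕₚ.n<1+n n))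

Σ<F-suc : ∀ N k → Σ< N (λ n → F n k) ≡ Σ< N (λ n → F n (suc k)) + G N k
-- The lower boundary term G 0 k is 0 through the factor n² of G.
Σ<F-suc zero    k = sym (trans (+-identityˡ (G 0 k))
  (ring (sgn k) 1ℚ (rising ½ k) (1/rising½ (suc k)) (1/fact- 0 (suc k)) 1ℚ 1ℚ))
  where
  ring : ∀ s R S e a f E → - ι 32 * s * R * S * (0ℚ * 0ℚ) * (e * e) * a * (f * f) * (E * E) ≡ 0ℚ
  ring = solve-∀ ℚ-ring
Σ<F-suc (suc N) k = trans (cong₂ _+_ (Σ<F-suc N k) (F-G-telescope N k))
  (ring (Σ< N (λ n → F n (suc k))) (G N k) (F N (suc k)) (G (suc N) k))
  where
  ring : ∀ a b c d → a + b + (c + (d - b)) ≡ a + c + d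
  ring = solve-∀ ℚ-ring

Σ<F : ∀ N k → Σ< N (λ n → F n 0) ≡ Σ< N (λ n → F n k) + Σ< k (G N)
Σ<F N zero    = sym (+-identityʳ _)
Σ<F N (suc k) = begin
  Σ< N (λ n → F n 0)                                    ≡⟨ Σ<F N k ⟩
  Σ< N (λ n → F n k) + Σ< k (G N)                       ≡⟨ cong (_+ Σ< k (G N)) (Σ<F-suc N k) ⟩
  Σ< N (λ n → F n (suc k)) + G N k + Σ< k (G N)         ≡⟨ ring (Σ< N (λ n → F n (suc k))) (G N k) (Σ< k (G N)) ⟩
  Σ< N (λ n → F n (suc k)) + (Σ< k (G N) + G N k)       ∎
  where
  ring : ∀ a b c → a + b + c ≡ a + (c + b)
  ring = solve-∀ ℚ-ring

F-< : ∀ {n k} → n < k → F n k ≡ 0ℚ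
F-< {n} {k} n<k = trans (F-term-cong (sgn (n ℕ.+ k)) (rising ½ n) (rising ½ (n ℕ.+ n ℕ.+ k)) (ι n) (ι k)
    (1/rising½ k) (1/fact- n k) (1/fact n) (1/4^ n)
    refl refl refl refl refl refl (1/fact--< n<k) refl refl)
  (ring (sgn (n ℕ.+ k)) (rising ½ n) (rising ½ (n ℕ.+ n ℕ.+ k)) (ι n) (ι k) (1/rising½ k) (1/fact n) (1/4^ n))
  where
  ring : ∀ s R S n k e f E →
    s * R * S * (ι 20 * n - ι 2 * k + ι 3) * (e * e) * 0ℚ * (f * f) * (E * E) ≡ 0ℚ
  ring = solve-∀ ℚ-ring

summand-Σ : ∀ K → (∑[ n < suc (K ℕ.+ K) ] summand (toℕ n))
  ≡ F K K + (Σ< K (λ m → F (suc K ℕ.+ m) K) + Σ< K (G (suc (K ℕ.+ K))))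
summand-Σ K = begin
  (∑[ n < N ] summand (toℕ n))                                             ≡⟨ ∑≡Σ< N summand ⟩
  Σ< N summand                                                             ≡⟨ Σ<-cong N summand≡F ⟩
  Σ< N (λ n → F n 0)                                                       ≡⟨ Σ<F N K ⟩
  Σ< N (λ n → F n K) + Γ                                                   ≡⟨ cong (_+ Γ) (Σ<-+ (suc K) K (λ n → F n K)) ⟩
  Σ< K (λ n → F n K) + F K K + Φ + Γ                                       ≡⟨ cong (λ x → x + F K K + Φ + Γ) (Σ<-zero K (λ _ → F-<)) ⟩
  0ℚ + F K K + Φ + Γ                                                       ≡⟨ ring (F K K) Φ Γ ⟩
  F K K + (Φ + Γ)                                                          ∎
  where
  N = suc (K ℕ.+ K)
  Γ = Σ< K (G N)
  Φ = Σ< K (λ m → F (suc K ℕ.+ m) K)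
  ring : ∀ a b c → 0ℚ + a + b + c ≡ a + (b + c)
  ring = solve-∀ ℚ-ring

-- Estimates modulo p ^ (r + 2)

module Estimates (p : ℕ) (p-prime : Prime p) (2∤p : 2 ∤ p)
                 (r K : ℕ) (p^r≡1+2K : p ℕ.^ r ≡ suc (K ℕ.+ K)) where

  open Localization p p-prime

  p∤2 : p ∤ 2
  p∤2 p∣2 = 2∤p (subst (2 ∣_) (ℕₚ.≤-antisym 1<p (∣⇒≤ p∣2)) ∣-refl)

  Div-½ : Div 0 ½
  Div-½ = Div-1/ 2 p∤2

  Div-1/4^ : ∀ n → Div 0 (1/4^ n)
  Div-1/4^ zero    = Div-ι 1
  Div-1/4^ (suc n) = Div-* (Div-1/4^ n) (Div-1/ 4 (p∤* 2 2 p∤2 p∤2))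

  Div-sgn : ∀ n → Div 0 (sgn n)
  Div-sgn zero    = Div-ι 1
  Div-sgn (suc n) = Div-neg (Div-sgn n)

  ν : ℚ
  ν = π^ r

  ν≡1+2K : ν ≡ 1ℚ + (ι K + ι K)
  ν≡1+2K = trans (cong ι p^r≡1+2K) (trans (ι-suc (K ℕ.+ K)) (cong (λ x → 1ℚ + x) (ι-+ K K)))

  <p^r : ∀ {n} → n ≤ K ℕ.+ K → n < p ℕ.^ r
  <p^r {n} n≤2K = subst (n <_) (sym p^r≡1+2K) (s≤s n≤2K)

  -- A positive integer below p ^ s has fewer than s factors p. They are cancelled against p ^ s one
  -- at a time until the denominator is prime to p; the strict bound survives each cancellation and
  -- leaves at least one p above.
  Div-π^/ : ∀ s j → suc j < p ℕ.^ s → Div 1 (π^ s * 1/1+ j)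
  Div-π^/ zero    j (s≤s ())
  Div-π^/ (suc s) j j< with p ∣? suc j
  ... | no p∤j = Div-≤ (s≤s z≤n) (Div-* (Div-π^ (suc s)) (Div-1/ (suc j) p∤j))
  ... | yes (divides (suc q) j≡qp) = subst (Div 1) (sym eq) (Div-π^/ s q
          (ℕₚ.*-cancelʳ-< p (suc q) (p ℕ.^ s) (subst₂ _<_ j≡qp (ℕₚ.*-comm p (p ℕ.^ s)) j<)))
    where
    1/1+q : ι p * 1/1+ j ≡ 1/1+ q
    1/1+q = inverse-unique {ι (suc q)} (begin
      ι (suc q) * (ι p * 1/1+ j)     ≡⟨ *-assoc (ι (suc q)) (ι p) (1/1+ j) ⟨
      ι (suc q) * ι p * 1/1+ j       ≡⟨ cong (_* 1/1+ j) (ι-* (suc q) p) ⟨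
      ι (suc q ℕ.* p) * 1/1+ j       ≡⟨ cong (λ k → ι k * 1/1+ j) j≡qp ⟨
      ι (suc j) * 1/1+ j             ≡⟨ ι*1/ (suc j) ⟩
      1ℚ ∎) (ι*1/ (suc q))
    ring : ∀ a b c → a * b * c ≡ b * (a * c)
    ring = solve-∀ ℚ-ring
    eq : π^ (suc s) * 1/1+ j ≡ π^ s * 1/1+ q
    eq = begin
      π^ (suc s) * 1/1+ j         ≡⟨ cong (_* 1/1+ j) (ι-* p (p ℕ.^ s)) ⟩
      ι p * π^ s * 1/1+ j         ≡⟨ ring (ι p) (π^ s) (1/1+ j) ⟩
      π^ s * (ι p * 1/1+ j)       ≡⟨ cong (π^ s *_) 1/1+q ⟩
      π^ s * 1/1+ q ∎

  Div-ν/ : ∀ j → suc j ≤ K ℕ.+ K → Div 1 (ν * 1/1+ j)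
  Div-ν/ j j<2K = Div-π^/ r j (<p^r j<2K)

  -- B (m + 1, l + 1) = ∫₀¹ tᵐ (1 - t)ˡ dt
  beta : ℕ → ℕ → ℚ
  beta m l = fact m * fact l * 1/fact (suc (m ℕ.+ l))

  beta-zero : ∀ m → beta m 0 ≡ 1/1+ m
  beta-zero m = begin
    fact m * 1ℚ * 1/fact (suc (m ℕ.+ 0))    ≡⟨ cong (λ k → fact m * 1ℚ * 1/fact (suc k)) (ℕₚ.+-identityʳ m) ⟩
    fact m * 1ℚ * (1/fact m * 1/1+ m)       ≡⟨ ring (fact m) (1/fact m) (1/1+ m) ⟩
    fact m * 1/fact m * 1/1+ m              ≡⟨ cong (_* 1/1+ m) (fact*1/fact m) ⟩
    1ℚ * 1/1+ m                             ≡⟨ *-identityˡ (1/1+ m) ⟩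
    1/1+ m ∎
    where
    ring : ∀ a b c → a * 1ℚ * (b * c) ≡ a * b * c
    ring = solve-∀ ℚ-ring

  -- Under the integral, (1 - t)ˡ⁺¹ = (1 - t)ˡ - t (1 - t)ˡ.
  beta-suc : ∀ m l → beta m (suc l) ≡ beta m l - beta (suc m) l
  beta-suc m l = begin
    fact m * fact (suc l) * 1/fact (suc (m ℕ.+ suc l))    ≡⟨ cong₂ (λ x k → fact m * x * 1/fact (suc k)) (fact-suc l) (ℕₚ.+-suc m l) ⟩
    fact m * ((1ℚ + ι l) * fact l) * g                    ≡⟨ ring (ι m) (ι l) (fact m) (fact l) g ⟩
    fact m * fact l * (g * (1ℚ + (1ℚ + (ι m + ι l)))) - (1ℚ + ι m) * fact m * fact l * g
      ≡⟨ cong₂ (λ x y → fact m * fact l * x - y * fact l * g)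
           (trans (1/fact-suc (suc (m ℕ.+ l))) (cong (λ x → g * (1ℚ + x)) (trans (ι-suc (m ℕ.+ l)) (cong (λ x → 1ℚ + x) (ι-+ m l)))))
           (fact-suc m) ⟨
    beta m l - beta (suc m) l ∎
    where
    g = 1/fact (suc (suc (m ℕ.+ l)))
    ring : ∀ m l f h g → f * ((1ℚ + l) * h) * g ≡ f * h * (g * (1ℚ + (1ℚ + (m + l)))) - (1ℚ + m) * f * h * g
    ring = solve-∀ ℚ-ring

  -- The recursion never increases m + l + 1, so it ends in reciprocals of integers that are at most
  -- 2K < N.
  Div-ν*beta : ∀ l m → suc (m ℕ.+ l) ≤ K ℕ.+ K → Div 1 (ν * beta m l)
  Div-ν*beta zero    m m<2K = subst (λ x → Div 1 (ν * x)) (sym (beta-zero m))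
    (Div-ν/ m (subst (λ k → suc k ≤ K ℕ.+ K) (ℕₚ.+-identityʳ m) m<2K))
  Div-ν*beta (suc l) m m+l<2K = subst (Div 1) (sym (trans (cong (ν *_) (beta-suc m l)) (ring ν (beta m l) (beta (suc m) l))))
    (Div-- (Div-ν*beta l m (ℕₚ.≤-trans (ℕₚ.n≤1+n _) m+1+l<2K)) (Div-ν*beta l (suc m) m+1+l<2K))
    where
    m+1+l<2K : suc (suc m ℕ.+ l) ≤ K ℕ.+ K
    m+1+l<2K = subst (λ k → suc k ≤ K ℕ.+ K) (ℕₚ.+-suc m l) m+l<2K
    ring : ∀ a b c → a * (b - c) ≡ a * b - a * c
    ring = solve-∀ ℚ-ring

  -- Comparison of rising factorials with factorials

  infix 4 _∣ᴿ_

  -- Divisibility up to ℤ₍ₚ₎ between arbitrary rationals: y may itself have factors p above or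
  -- below. As the relation is multiplicative, each factor of a term can be replaced separately and
  -- only the product of the replacements needs to be estimated.
  _∣ᴿ_ : ℚ → ℚ → Set
  y ∣ᴿ x = ∃ λ z → Div 0 z × x ≡ z * y

  ∣ᴿ-refl : ∀ x → x ∣ᴿ x
  ∣ᴿ-refl x = 1ℚ , Div-ι 1 , sym (*-identityˡ x)

  ∣ᴿ-*ˡ : ∀ {y x} z → Div 0 z → y ∣ᴿ x → y ∣ᴿ z * x
  ∣ᴿ-*ˡ {y} z Dz (w , Dw , x≡wy) = z * w , Div-* Dz Dw , trans (cong (z *_) x≡wy) (sym (*-assoc z w y))

  ∣ᴿ-* : ∀ {y x y′ x′} → y ∣ᴿ x → y′ ∣ᴿ x′ → y * y′ ∣ᴿ x * x′
  ∣ᴿ-* {y} {_} {y′} (z , Dz , x≡zy) (z′ , Dz′ , x′≡z′y′) =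
    z * z′ , Div-* Dz Dz′ , trans (cong₂ _*_ x≡zy x′≡z′y′) (ring z y z′ y′)
    where
    ring : ∀ a b c d → a * b * (c * d) ≡ a * c * (b * d)
    ring = solve-∀ ℚ-ring

  Div-∣ᴿ : ∀ {m y x} → y ∣ᴿ x → Div m y → Div m x
  Div-∣ᴿ (z , Dz , x≡zy) Dy = subst (Div _) (sym x≡zy) (Div-* Dz Dy)

  -- Factor by factor: j + c ν = (1 + c ν / j) j, where ν / j is p-integral since 0 < j ≤ 2K < N.
  rising-∣ᴿ : ∀ {c} → Div 0 c → ∀ d n → d ℕ.+ n ≤ K ℕ.+ K →
              rising (1ℚ + ι d) n ∣ᴿ rising (1ℚ + ι d + c * ν) n
  rising-∣ᴿ {c} Dc d zero    _ = ∣ᴿ-refl 1ℚ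
  rising-∣ᴿ {c} Dc d (suc n) d+n<2K = ∣ᴿ-* (rising-∣ᴿ Dc d n (ℕₚ.≤-trans (ℕₚ.n≤1+n _) 1+d+n≤2K))
    (1ℚ + c * (ν * 1/1+ (d ℕ.+ n)) ,
     Div-+ (Div-ι 1) (Div-* Dc (Div-≤ z≤n (Div-ν/ (d ℕ.+ n) 1+d+n≤2K))) , (begin
      1ℚ + ι d + c * ν + ι n                                    ≡⟨ ring₁ (ι d) c ν (ι n) ⟩
      1ℚ + (ι d + ι n) + c * ν * 1ℚ                             ≡⟨ cong₂ (λ x y → 1ℚ + x + c * ν * y) (ι-+ d n) (1+*1/1+ (d ℕ.+ n)) ⟨
      1ℚ + ι (d ℕ.+ n) + c * ν * ((1ℚ + ι (d ℕ.+ n)) * 1/1+ (d ℕ.+ n)) ≡⟨ ring₂ c ν (ι (d ℕ.+ n)) (1/1+ (d ℕ.+ n)) ⟩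
      (1ℚ + c * (ν * 1/1+ (d ℕ.+ n))) * (1ℚ + ι (d ℕ.+ n))      ≡⟨ cong (λ x → (1ℚ + c * (ν * 1/1+ (d ℕ.+ n))) * x) (trans (cong (λ x → 1ℚ + x) (ι-+ d n)) (sym (+-assoc 1ℚ (ι d) (ι n)))) ⟩
      (1ℚ + c * (ν * 1/1+ (d ℕ.+ n))) * (1ℚ + ι d + ι n)        ∎))
    where
    1+d+n≤2K : suc (d ℕ.+ n) ≤ K ℕ.+ K
    1+d+n≤2K = subst (_≤ K ℕ.+ K) (ℕₚ.+-suc d n) d+n<2K
    ring₁ : ∀ d c v n → 1ℚ + d + c * v + n ≡ 1ℚ + (d + n) + c * v * 1ℚ
    ring₁ = solve-∀ ℚ-ring
    ring₂ : ∀ c v d i → 1ℚ + d + c * v * ((1ℚ + d) * i) ≡ (1ℚ + c * (v * i)) * (1ℚ + d)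
    ring₂ = solve-∀ ℚ-ring

  fact-∣ᴿ-rising : ∀ {c} → Div 0 c → ∀ n → n ≤ K ℕ.+ K → fact n ∣ᴿ rising (1ℚ + c * ν) n
  fact-∣ᴿ-rising {c} Dc n n≤2K = subst (_∣ᴿ rising (1ℚ + c * ν) n) (sym (fact≡rising n)) (rising-∣ᴿ Dc 0 n n≤2K)

  K≤2K : K ≤ K ℕ.+ K
  K≤2K = ℕₚ.m≤m+n K K

  -- Reflection yields the factors j - (c + ½) ν for l < j ≤ K, whose integer parts multiply to K! /
  -- l!. The parameter c serves the blocks of a long rising factorial that start at ½ + ν or ½ + 2
  -- ν.
  rising½-∣ᴿ : ∀ {c} → Div 0 c → ∀ k l → k ℕ.+ l ≡ K → fact K * 1/fact l ∣ᴿ rising (½ + c * ν) k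
  rising½-∣ᴿ {c} Dc k l k+l≡K = subst₂ _∣ᴿ_ (sym lhs) (sym rhs)
    (∣ᴿ-*ˡ (sgn k) (Div-sgn k) (rising-∣ᴿ (Div-neg (Div-+ Dc Div-½)) l k
      (subst (_≤ K ℕ.+ K) (trans (sym k+l≡K) (ℕₚ.+-comm k l)) K≤2K)))
    where
    lhs : fact K * 1/fact l ≡ rising (1ℚ + ι l) k
    lhs = begin
      fact K * 1/fact l                           ≡⟨ cong (λ n → fact n * 1/fact l) (trans (sym k+l≡K) (ℕₚ.+-comm k l)) ⟩
      fact (l ℕ.+ k) * 1/fact l                   ≡⟨ cong (_* 1/fact l) (fact-+ l k) ⟩
      fact l * rising (1ℚ + ι l) k * 1/fact l     ≡⟨ ring (fact l) (rising (1ℚ + ι l) k) (1/fact l) ⟩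
      fact l * 1/fact l * rising (1ℚ + ι l) k     ≡⟨ cong (_* rising (1ℚ + ι l) k) (fact*1/fact l) ⟩
      1ℚ * rising (1ℚ + ι l) k                    ≡⟨ *-identityˡ _ ⟩
      rising (1ℚ + ι l) k ∎
      where
      ring : ∀ a b c → a * b * c ≡ a * c * b
      ring = solve-∀ ℚ-ring
    base : 1ℚ - (½ + c * ν) - ι k ≡ 1ℚ + ι l + - (c + ½) * ν
    base = begin
      1ℚ - (½ + c * ν) - ι k                                              ≡⟨ ring₁ c ν (ι k) (ι l) ⟩
      1ℚ + ι l + - c * ν - ½ * (1ℚ + ((ι k + ι l) + (ι k + ι l)))         ≡⟨ cong (λ x → 1ℚ + ι l + - c * ν - ½ * x) ν≡ ⟨
      1ℚ + ι l + - c * ν - ½ * ν                                          ≡⟨ ring₂ c ν (ι l) ⟩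
      1ℚ + ι l + - (c + ½) * ν                                            ∎
      where
      ν≡ : ν ≡ 1ℚ + ((ι k + ι l) + (ι k + ι l))
      ν≡ = trans ν≡1+2K (cong (λ x → 1ℚ + (x + x)) (trans (cong ι (sym k+l≡K)) (ι-+ k l)))
      ring₁ : ∀ c v k l → 1ℚ - (½ + c * v) - k ≡ 1ℚ + l + - c * v - ½ * (1ℚ + ((k + l) + (k + l)))
      ring₁ = solve-∀ ℚ-ring
      ring₂ : ∀ c v l → 1ℚ + l + - c * v - ½ * v ≡ 1ℚ + l + - (c + ½) * v
      ring₂ = solve-∀ ℚ-ring
    rhs : rising (½ + c * ν) k ≡ sgn k * rising (1ℚ + ι l + - (c + ½) * ν) k
    rhs = trans (rising-reflect (½ + c * ν) k) (cong (λ x → sgn k * rising x k) base)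

  -- The factor of index K is ½ + K + c ν = (c + ½) ν: here the powers of N come from. Beyond it the
  -- factors are j + (c + ½) ν with j = 1, 2, ....
  rising½-K : ∀ c m → rising (½ + c * ν) (K ℕ.+ suc m)
    ≡ rising (½ + c * ν) K * ((c + ½) * (ν * rising (1ℚ + (c + ½) * ν) m))
  rising½-K c m = begin
    rising (½ + c * ν) (K ℕ.+ suc m)                                         ≡⟨ rising-+ (½ + c * ν) K (suc m) ⟩
    rising (½ + c * ν) K * rising (½ + c * ν + ι K) (suc m)                  ≡⟨ cong (λ x → rising (½ + c * ν) K * rising x (suc m)) base ⟩
    rising (½ + c * ν) K * rising ((c + ½) * ν) (suc m)                      ≡⟨ cong (rising (½ + c * ν) K *_) (rising-suc ((c + ½) * ν) m) ⟩
    rising (½ + c * ν) K * ((c + ½) * ν * rising ((c + ½) * ν + 1ℚ) m)       ≡⟨ cong (λ x → rising (½ + c * ν) K * ((c + ½) * ν * rising x m)) (+-comm ((c + ½) * ν) 1ℚ) ⟩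
    rising (½ + c * ν) K * ((c + ½) * ν * rising (1ℚ + (c + ½) * ν) m)       ≡⟨ cong (rising (½ + c * ν) K *_) (*-assoc (c + ½) ν _) ⟩
    rising (½ + c * ν) K * ((c + ½) * (ν * rising (1ℚ + (c + ½) * ν) m))     ∎
    where
    base : ½ + c * ν + ι K ≡ (c + ½) * ν
    base = begin
      ½ + c * ν + ι K                         ≡⟨ ring₁ c ν (ι K) ⟩
      c * ν + ½ * (1ℚ + (ι K + ι K))          ≡⟨ cong (λ x → c * ν + ½ * x) ν≡1+2K ⟨
      c * ν + ½ * ν                           ≡⟨ ring₂ c ν ⟩
      (c + ½) * ν                             ∎
      where
      ring₁ : ∀ c v k → ½ + c * v + k ≡ c * v + ½ * (1ℚ + (k + k))
      ring₁ = solve-∀ ℚ-ring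
      ring₂ : ∀ c v → c * v + ½ * v ≡ (c + ½) * v
      ring₂ = solve-∀ ℚ-ring

  fact-∣ᴿ-rising½ : ∀ {c} → Div 0 c → fact K ∣ᴿ rising (½ + c * ν) K
  fact-∣ᴿ-rising½ {c} Dc = subst (_∣ᴿ rising (½ + c * ν) K) (*-identityʳ (fact K))
    (rising½-∣ᴿ Dc K 0 (ℕₚ.+-identityʳ K))

  rising½-K-∣ᴿ : ∀ {c} → Div 0 c → ∀ m → m ≤ K ℕ.+ K →
                 fact K * (ν * fact m) ∣ᴿ rising (½ + c * ν) (K ℕ.+ suc m)
  rising½-K-∣ᴿ {c} Dc m m≤2K = subst (fact K * (ν * fact m) ∣ᴿ_) (sym (rising½-K c m))
    (∣ᴿ-* (fact-∣ᴿ-rising½ Dc) (∣ᴿ-*ˡ (c + ½) Dc+½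
      (∣ᴿ-* (∣ᴿ-refl ν) (fact-∣ᴿ-rising Dc+½ m m≤2K))))
    where
    Dc+½ : Div 0 (c + ½)
    Dc+½ = Div-+ Dc Div-½

  -- Reciprocals of factorials and of rising factorials

  rising-1-ν-inverse : ∀ k → k ≤ K ℕ.+ K → ∃ λ w → Div 0 w × rising (1ℚ + - 1ℚ * ν) k * w ≡ fact k
  rising-1-ν-inverse zero    _ = 1ℚ , Div-ι 1 , refl
  rising-1-ν-inverse (suc k) k<2K = extend
    (rising-1-ν-inverse k (ℕₚ.≤-trans (ℕₚ.n≤1+n k) k<2K)) (inverse-1- (Div-ν/ k k<2K))
    where
    x = rising (1ℚ + - 1ℚ * ν) k
    ring₁ : ∀ x n k w v → x * (1ℚ + - 1ℚ * n + k) * (w * v) ≡ x * w * ((1ℚ + k) * v - n * v * 1ℚ)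
    ring₁ = solve-∀ ℚ-ring
    ring₂ : ∀ x n k v i → x * ((1ℚ + k) * v - n * v * ((1ℚ + k) * i)) ≡ (1ℚ + k) * x * ((1ℚ - n * i) * v)
    ring₂ = solve-∀ ℚ-ring
    extend : (∃ λ w → Div 0 w × x * w ≡ fact k) → (∃ λ v → Div 0 v × (1ℚ - ν * 1/1+ k) * v ≡ 1ℚ) →
             ∃ λ w → Div 0 w × rising (1ℚ + - 1ℚ * ν) (suc k) * w ≡ fact (suc k)
    extend (w , Dw , eq) (v , Dv , eq′) = w * v , Div-* Dw Dv , (begin
      x * (1ℚ + - 1ℚ * ν + ι k) * (w * v)                           ≡⟨ ring₁ x ν (ι k) w v ⟩
      x * w * ((1ℚ + ι k) * v - ν * v * 1ℚ)                         ≡⟨ cong (λ y → x * w * ((1ℚ + ι k) * v - ν * v * y)) (1+*1/1+ k) ⟨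
      x * w * ((1ℚ + ι k) * v - ν * v * ((1ℚ + ι k) * 1/1+ k))      ≡⟨ ring₂ (x * w) ν (ι k) v (1/1+ k) ⟩
      (1ℚ + ι k) * (x * w) * ((1ℚ - ν * 1/1+ k) * v)                ≡⟨ cong₂ (λ y z → (1ℚ + ι k) * y * z) eq eq′ ⟩
      (1ℚ + ι k) * fact k * 1ℚ                                      ≡⟨ *-identityʳ _ ⟩
      (1ℚ + ι k) * fact k                                           ≡⟨ fact-suc k ⟨
      fact (suc k) ∎)

  -- The inverse of ∏ (1 - ν / j) over 1 ≤ j ≤ K. It is p-integral because ν / j ∈ p ℤ₍ₚ₎, and all
  -- reciprocals below are reduced to this single inversion.
  W : ℚ
  W = proj₁ (rising-1-ν-inverse K K≤2K)

  Div-W : Div 0 W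
  Div-W = proj₁ (proj₂ (rising-1-ν-inverse K K≤2K))

  rising-1-ν*W : rising (1ℚ + - 1ℚ * ν) K * W ≡ fact K
  rising-1-ν*W = proj₂ (proj₂ (rising-1-ν-inverse K K≤2K))

  -- The upper half of (2K)! consists of the numbers ν - j with 1 ≤ j ≤ K.
  fact-2K : fact (K ℕ.+ K) ≡ fact K * (sgn K * rising (1ℚ + - 1ℚ * ν) K)
  fact-2K = trans (fact-+ K K) (cong (fact K *_) (trans (rising-reflect (1ℚ + ι K) K)
    (cong (λ x → sgn K * rising x K) (trans (ring (ι K)) (cong (λ x → 1ℚ + - 1ℚ * x) (sym ν≡1+2K))))))
    where
    ring : ∀ k → 1ℚ - (1ℚ + k) - k ≡ 1ℚ + - 1ℚ * (1ℚ + (k + k))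
    ring = solve-∀ ℚ-ring

  1/fact-2K : 1/fact (K ℕ.+ K) ≡ sgn K * W * (1/fact K * 1/fact K)
  1/fact-2K = inverse-unique {fact (K ℕ.+ K)} (fact*1/fact (K ℕ.+ K)) (begin
    fact (K ℕ.+ K) * (sgn K * W * (1/fact K * 1/fact K))          ≡⟨ cong (_* (sgn K * W * (1/fact K * 1/fact K))) fact-2K ⟩
    fact K * (sgn K * X) * (sgn K * W * (1/fact K * 1/fact K))    ≡⟨ ring₁ (fact K) (sgn K) X W (1/fact K) ⟩
    sgn K * sgn K * (X * W * 1/fact K) * (fact K * 1/fact K)      ≡⟨ cong₂ (λ x y → x * (y * 1/fact K) * (fact K * 1/fact K)) (sgn² K) rising-1-ν*W ⟩
    1ℚ * (fact K * 1/fact K) * (fact K * 1/fact K)                ≡⟨ cong (λ x → 1ℚ * x * x) (fact*1/fact K) ⟩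
    1ℚ ∎)
    where
    X = rising (1ℚ + - 1ℚ * ν) K
    ring₁ : ∀ f s x w g → f * (s * x) * (s * w * (g * g)) ≡ s * s * (x * w * g) * (f * g)
    ring₁ = solve-∀ ℚ-ring

  -- Completing n! to (2K)! gives 1 / n! = (n + 1)_l / (2K)!. The numerator reflects to an integral
  -- multiple of l!, and the denominator is K!² up to sign and `W`.
  1/fact-∣ᴿ : ∀ n l → n ℕ.+ l ≡ K ℕ.+ K → fact l * (1/fact K * 1/fact K) ∣ᴿ 1/fact n
  1/fact-∣ᴿ n l n+l≡2K = subst (fact l * (1/fact K * 1/fact K) ∣ᴿ_) (sym eq)
    (∣ᴿ-* (∣ᴿ-*ˡ (sgn l) (Div-sgn l) (fact-∣ᴿ-rising (Div-⟦⟧ -1ℤ) l (subst (l ≤_) n+l≡2K (ℕₚ.m≤n+m l n))))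
          (∣ᴿ-*ˡ (sgn K * W) (Div-* (Div-sgn K) Div-W) (∣ᴿ-refl _)))
    where
    base : 1ℚ - (1ℚ + ι n) - ι l ≡ 1ℚ + - 1ℚ * ν
    base = begin
      1ℚ - (1ℚ + ι n) - ι l             ≡⟨ ring (ι n) (ι l) ⟩
      1ℚ + - 1ℚ * (1ℚ + (ι n + ι l))    ≡⟨ cong (λ x → 1ℚ + - 1ℚ * (1ℚ + x)) (trans (sym (ι-+ n l)) (trans (cong ι n+l≡2K) (ι-+ K K))) ⟩
      1ℚ + - 1ℚ * (1ℚ + (ι K + ι K))    ≡⟨ cong (λ x → 1ℚ + - 1ℚ * x) ν≡1+2K ⟨
      1ℚ + - 1ℚ * ν                     ∎
      where
      ring : ∀ n l → 1ℚ - (1ℚ + n) - l ≡ 1ℚ + - 1ℚ * (1ℚ + (n + l))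
      ring = solve-∀ ℚ-ring
    eq : 1/fact n ≡ sgn l * rising (1ℚ + - 1ℚ * ν) l * (sgn K * W * (1/fact K * 1/fact K))
    eq = begin
      1/fact n                                              ≡⟨ inverse-unique {fact n} (fact*1/fact n) (begin
          fact n * (rising (1ℚ + ι n) l * 1/fact (K ℕ.+ K))   ≡⟨ *-assoc (fact n) (rising (1ℚ + ι n) l) (1/fact (K ℕ.+ K)) ⟨
          fact n * rising (1ℚ + ι n) l * 1/fact (K ℕ.+ K)     ≡⟨ cong (_* 1/fact (K ℕ.+ K)) (fact-+ n l) ⟨
          fact (n ℕ.+ l) * 1/fact (K ℕ.+ K)                   ≡⟨ cong (λ k → fact k * 1/fact (K ℕ.+ K)) n+l≡2K ⟩
          fact (K ℕ.+ K) * 1/fact (K ℕ.+ K)                   ≡⟨ fact*1/fact (K ℕ.+ K) ⟩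
          1ℚ ∎) ⟩
      rising (1ℚ + ι n) l * 1/fact (K ℕ.+ K)                ≡⟨ cong₂ _*_ (trans (rising-reflect (1ℚ + ι n) l) (cong (λ x → sgn l * rising x l) base)) 1/fact-2K ⟩
      sgn l * rising (1ℚ + - 1ℚ * ν) l * (sgn K * W * (1/fact K * 1/fact K)) ∎

  ½-K≡1-½ν : 1ℚ - ½ - ι K ≡ 1ℚ + - ½ * ν
  ½-K≡1-½ν = trans (ring (ι K)) (cong (λ x → 1ℚ + - ½ * x) (sym ν≡1+2K))
    where
    ring : ∀ k → 1ℚ - ½ - k ≡ 1ℚ + - ½ * (1ℚ + (k + k))
    ring = solve-∀ ℚ-ring

  rising½≡ : rising ½ K ≡ sgn K * rising (1ℚ + - ½ * ν) K
  rising½≡ = trans (rising-reflect ½ K) (cong (λ x → sgn K * rising x K) ½-K≡1-½ν)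

  -- The duplication formula for n = K, with both (½)_K and (2K)! reflected. Dividing by K! exhibits
  -- 4 ^ -K as ∏ (1 - ν / 2j) / ∏ (1 - ν / j).
  rising-1-½ν : rising (1ℚ + - ½ * ν) K ≡ 1/4^ K * rising (1ℚ + - 1ℚ * ν) K
  rising-1-½ν = begin
    Y                                                             ≡⟨ ring₁ Y ⟩
    1ℚ * 1ℚ * Y                                                   ≡⟨ cong₂ (λ x y → x * y * Y) (sgn² K) (fact*1/fact K) ⟨
    sgn K * sgn K * (fact K * 1/fact K) * Y                       ≡⟨ ring₂ (sgn K) (fact K) (1/fact K) Y ⟩
    fact K * (sgn K * Y) * (sgn K * 1/fact K)                     ≡⟨ cong (λ x → fact K * x * (sgn K * 1/fact K)) rising½≡ ⟨
    fact K * rising ½ K * (sgn K * 1/fact K)                      ≡⟨ cong (_* (sgn K * 1/fact K)) (fact-duplication K) ⟨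
    fact (K ℕ.+ K) * 1/4^ K * (sgn K * 1/fact K)                  ≡⟨ cong (λ x → x * 1/4^ K * (sgn K * 1/fact K)) fact-2K ⟩
    fact K * (sgn K * X) * 1/4^ K * (sgn K * 1/fact K)            ≡⟨ ring₃ (fact K) (sgn K) X (1/4^ K) (1/fact K) ⟩
    sgn K * sgn K * (fact K * 1/fact K) * (1/4^ K * X)            ≡⟨ cong₂ (λ x y → x * y * (1/4^ K * X)) (sgn² K) (fact*1/fact K) ⟩
    1ℚ * 1ℚ * (1/4^ K * X)                                        ≡⟨ ring₁ (1/4^ K * X) ⟨
    1/4^ K * X ∎
    where
    X = rising (1ℚ + - 1ℚ * ν) K
    Y = rising (1ℚ + - ½ * ν) K
    ring₁ : ∀ y → y ≡ 1ℚ * 1ℚ * y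
    ring₁ = solve-∀ ℚ-ring
    ring₂ : ∀ s f g y → s * s * (f * g) * y ≡ f * (s * y) * (s * g)
    ring₂ = solve-∀ ℚ-ring
    ring₃ : ∀ f s x q g → f * (s * x) * q * (s * g) ≡ s * s * (f * g) * (q * x)
    ring₃ = solve-∀ ℚ-ring

  1/rising½-K : 1/rising½ K ≡ sgn K * (ι (4 ℕ.^ K) * W) * 1/fact K
  1/rising½-K = inverse-unique {rising ½ K} (rising½*1/rising½ K) (begin
    rising ½ K * (sgn K * (ι (4 ℕ.^ K) * W) * 1/fact K)                     ≡⟨ cong (_* (sgn K * (ι (4 ℕ.^ K) * W) * 1/fact K)) (trans rising½≡ (cong (sgn K *_) rising-1-½ν)) ⟩
    sgn K * (1/4^ K * X) * (sgn K * (ι (4 ℕ.^ K) * W) * 1/fact K)           ≡⟨ ring (sgn K) (1/4^ K) X (ι (4 ℕ.^ K)) W (1/fact K) ⟩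
    sgn K * sgn K * (ι (4 ℕ.^ K) * 1/4^ K) * (X * W * 1/fact K)             ≡⟨ cong₂ _*_ (cong₂ _*_ (sgn² K) (4^*1/4^ K)) (trans (cong (_* 1/fact K) rising-1-ν*W) (fact*1/fact K)) ⟩
    1ℚ ∎)
    where
    X = rising (1ℚ + - 1ℚ * ν) K
    ring : ∀ s q x o w g → s * (q * x) * (s * (o * w) * g) ≡ s * s * (o * q) * (x * w * g)
    ring = solve-∀ ℚ-ring

  -- As for 1 / n!, the product is completed, here to (½)_K, whose reciprocal is 1 / K! up to the
  -- integral factor 4ᴷ `W` and a sign.
  1/rising½-∣ᴿ : ∀ k l → k ℕ.+ l ≡ K → fact l * 1/fact K ∣ᴿ 1/rising½ k
  1/rising½-∣ᴿ k l k+l≡K = subst (fact l * 1/fact K ∣ᴿ_) (sym eq)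
    (∣ᴿ-* (∣ᴿ-*ˡ (sgn l) (Div-sgn l) (fact-∣ᴿ-rising (Div-neg Div-½) l
            (ℕₚ.≤-trans (subst (l ≤_) k+l≡K (ℕₚ.m≤n+m l k)) K≤2K)))
          (∣ᴿ-*ˡ (sgn K * (ι (4 ℕ.^ K) * W)) (Div-* (Div-sgn K) (Div-* (Div-ι (4 ℕ.^ K)) Div-W)) (∣ᴿ-refl (1/fact K))))
    where
    base : 1ℚ - (½ + ι k) - ι l ≡ 1ℚ + - ½ * ν
    base = begin
      1ℚ - (½ + ι k) - ι l   ≡⟨ ring (ι k) (ι l) ⟩
      1ℚ - ½ - (ι k + ι l)   ≡⟨ cong (λ x → 1ℚ - ½ - x) (trans (sym (ι-+ k l)) (cong ι k+l≡K)) ⟩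
      1ℚ - ½ - ι K           ≡⟨ ½-K≡1-½ν ⟩
      1ℚ + - ½ * ν           ∎
      where
      ring : ∀ k l → 1ℚ - (½ + k) - l ≡ 1ℚ - ½ - (k + l)
      ring = solve-∀ ℚ-ring
    eq : 1/rising½ k ≡ sgn l * rising (1ℚ + - ½ * ν) l * (sgn K * (ι (4 ℕ.^ K) * W) * 1/fact K)
    eq = begin
      1/rising½ k                                             ≡⟨ inverse-unique {rising ½ k} (rising½*1/rising½ k) (begin
          rising ½ k * (rising (½ + ι k) l * 1/rising½ K)       ≡⟨ *-assoc (rising ½ k) (rising (½ + ι k) l) (1/rising½ K) ⟨
          rising ½ k * rising (½ + ι k) l * 1/rising½ K         ≡⟨ cong (_* 1/rising½ K) (rising-+ ½ k l) ⟨
          rising ½ (k ℕ.+ l) * 1/rising½ K                      ≡⟨ cong (λ n → rising ½ n * 1/rising½ K) k+l≡K ⟩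
          rising ½ K * 1/rising½ K                              ≡⟨ rising½*1/rising½ K ⟩
          1ℚ ∎) ⟩
      rising (½ + ι k) l * 1/rising½ K                        ≡⟨ cong₂ _*_ (trans (rising-reflect (½ + ι k) l) (cong (λ x → sgn l * rising x l) base)) 1/rising½-K ⟩
      sgn l * rising (1ℚ + - ½ * ν) l * (sgn K * (ι (4 ℕ.^ K) * W) * 1/fact K) ∎

  -- Integrality, and products of factors 1 + c ν / j

  Div-binomial : ∀ m n → Div 0 (binomial m n)
  Div-binomial zero    n       = subst (Div 0) (sym (trans (cong (fact n *_) (*-identityˡ (1/fact n))) (fact*1/fact n))) (Div-ι 1)
  Div-binomial (suc m) zero    = subst (Div 0) (sym (trans (cong₂ (λ k x → fact k * x) (ℕₚ.+-identityʳ (suc m)) (*-identityʳ (1/fact (suc m)))) (fact*1/fact (suc m)))) (Div-ι 1)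
  Div-binomial (suc m) (suc n) = subst (Div 0) (sym (binomial-suc m n)) (Div-+ (Div-binomial m (suc n)) (Div-binomial (suc m) n))

  Div-catalan : ∀ n → Div 0 (catalan n)
  Div-catalan zero    = Div-ι 1
  Div-catalan (suc n) = subst (Div 0) (sym (catalan-binomial n)) (Div-- (Div-binomial (suc n) (suc n)) (Div-binomial (suc (suc n)) n))

  -- ∏ (1 + c ν / j) over 1 ≤ j ≤ n
  X : ℚ → ℕ → ℚ
  X c n = rising (1ℚ + c * ν) n * 1/fact n

  X-suc : ∀ c n → X c (suc n) ≡ X c n * (1ℚ + c * (ν * 1/1+ n))
  X-suc c n = begin
    x * (1ℚ + c * ν + ι n) * (f * i)                  ≡⟨ ring₁ x f i (c * ν) (ι n) ⟩
    x * f * ((1ℚ + ι n) * i + c * ν * i)              ≡⟨ cong (λ y → x * f * (y + c * ν * i)) (1+*1/1+ n) ⟩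
    x * f * (1ℚ + c * ν * i)                          ≡⟨ cong (λ y → x * f * (1ℚ + y)) (*-assoc c ν i) ⟩
    x * f * (1ℚ + c * (ν * i))                        ∎
    where
    x = rising (1ℚ + c * ν) n
    f = 1/fact n
    i = 1/1+ n
    ring₁ : ∀ x f i c n → x * (1ℚ + c + n) * (f * i) ≡ x * f * ((1ℚ + n) * i + c * i)
    ring₁ = solve-∀ ℚ-ring

  Div-X : ∀ {c} → Div 0 c → ∀ n → n ≤ K ℕ.+ K → Div 0 (X c n)
  Div-X {c} Dc n n≤2K = Div-∣ᴿ (∣ᴿ-* (fact-∣ᴿ-rising Dc n n≤2K) (∣ᴿ-refl (1/fact n)))
    (subst (Div 0) (sym (fact*1/fact n)) (Div-ι 1))

  -- For n = K these come from F K K: (½)_{3K+1} contributes the parameters ½ and -3/2, and 16 ^ -K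
  -- contributes the square at -½ together with the denominator `Q`, which `W` inverts.
  P Q : ℕ → ℚ
  P n = X ½ n * X (- (1ℚ + ½)) n * (X (- ½) n * X (- ½) n)
  Q n = X (- 1ℚ) n * X (- 1ℚ) n

  Div-3/2 : Div 0 (- (1ℚ + ½))
  Div-3/2 = Div-neg (Div-+ (Div-ι 1) Div-½)

  -- With x = ν / 2j ∈ p ℤ₍ₚ₎, the j-th factors agree modulo p² because
  -- (1 + x) (1 - 3x) (1 - x)² = (1 - 2x)² - x² (2 - 4x + 3x²).
  P≡Q : ∀ n → n ≤ K ℕ.+ K → Div 2 (P n - Q n)
  P≡Q zero    _ = Div-0
  P≡Q (suc n) n<2K = subst (Div 2) (sym eq) (Div-- (Div-* (P≡Q n n≤2K) (Div-* D-1 D-1))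
    (Div-* (Div-* (Div-* Dy Dy) (Div-1/ 4 (p∤* 2 2 p∤2 p∤2)))
           (Div-* DP (Div-+ (Div-- (Div-ι 2) (Div-* (Div-ι 2) Dy₀)) (Div-* (Div-* (Div-ι 3) (Div-1/ 4 (p∤* 2 2 p∤2 p∤2))) (Div-* Dy₀ Dy₀))))))
    where
    y = ν * 1/1+ n
    Dy : Div 1 y
    Dy = Div-ν/ n n<2K
    Dy₀ : Div 0 y
    Dy₀ = Div-≤ z≤n Dy
    n≤2K : n ≤ K ℕ.+ K
    n≤2K = ℕₚ.≤-trans (ℕₚ.n≤1+n n) n<2K
    D-1 : Div 0 (1ℚ + - 1ℚ * y)
    D-1 = Div-+ (Div-ι 1) (Div-* (Div-⟦⟧ -1ℤ) Dy₀)
    DP : Div 0 (P n)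
    DP = Div-* (Div-* (Div-X Div-½ n n≤2K) (Div-X Div-3/2 n n≤2K))
               (Div-* (Div-X (Div-neg Div-½) n n≤2K) (Div-X (Div-neg Div-½) n n≤2K))
    ring : ∀ a b c d y →
      a * (1ℚ + ½ * y) * (b * (1ℚ + - (1ℚ + ½) * y)) * (c * (1ℚ + - ½ * y) * (c * (1ℚ + - ½ * y)))
        - d * (1ℚ + - 1ℚ * y) * (d * (1ℚ + - 1ℚ * y))
      ≡ (a * b * (c * c) - d * d) * ((1ℚ + - 1ℚ * y) * (1ℚ + - 1ℚ * y))
        - y * y * (1ℤ / 4) * (a * b * (c * c) * (ι 2 - ι 2 * y + ι 3 * (1ℤ / 4) * (y * y)))
    ring = solve-∀ ℚ-ring
    eq : P (suc n) - Q (suc n) ≡ (P n - Q n) * ((1ℚ + - 1ℚ * y) * (1ℚ + - 1ℚ * y))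
        - y * y * (1ℤ / 4) * (P n * (ι 2 - ι 2 * y + ι 3 * (1ℤ / 4) * (y * y)))
    eq = trans (cong₂ _-_
        (cong₂ _*_ (cong₂ _*_ (X-suc ½ n) (X-suc (- (1ℚ + ½)) n)) (cong₂ _*_ (X-suc (- ½) n) (X-suc (- ½) n)))
        (cong₂ _*_ (X-suc (- 1ℚ) n) (X-suc (- 1ℚ) n)))
      (ring (X ½ n) (X (- (1ℚ + ½)) n) (X (- ½) n) (X (- 1ℚ) n) y)

  -- The main term F K K

  X-1*W : X (- 1ℚ) K * W ≡ 1ℚ
  X-1*W = trans (ring (rising (1ℚ + - 1ℚ * ν) K) (1/fact K) W) (trans (cong (_* 1/fact K) rising-1-ν*W) (fact*1/fact K))
    where
    ring : ∀ a b c → a * b * c ≡ a * c * b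
    ring = solve-∀ ℚ-ring

  1/4^K≡X-½*W : 1/4^ K ≡ X (- ½) K * W
  1/4^K≡X-½*W = sym (begin
    rising (1ℚ + - ½ * ν) K * 1/fact K * W                    ≡⟨ cong (λ x → x * 1/fact K * W) rising-1-½ν ⟩
    1/4^ K * rising (1ℚ + - 1ℚ * ν) K * 1/fact K * W          ≡⟨ ring (1/4^ K) (rising (1ℚ + - 1ℚ * ν) K) (1/fact K) W ⟩
    1/4^ K * (X (- 1ℚ) K * W)                                 ≡⟨ cong (1/4^ K *_) X-1*W ⟩
    1/4^ K * 1ℚ                                               ≡⟨ *-identityʳ (1/4^ K) ⟩
    1/4^ K ∎)
    where
    ring : ∀ a b c d → a * b * c * d ≡ a * (b * c * d)
    ring = solve-∀ ℚ-ring

  ½+0ν : ½ + 0ℚ * ν ≡ ½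
  ½+0ν = cong (λ x → ½ + x) (*-zeroˡ ν)

  ι-N : ι (K ℕ.+ suc K) ≡ ν
  ι-N = cong ι (trans (ℕₚ.+-suc K K) (sym p^r≡1+2K))

  -- Cut at N = 2K + 1: the first block passes the factor ν / 2, and the second starts at ½ + ν with
  -- length K, one short of 3 ν / 2.
  rising½-3K+1 : rising ½ (suc (K ℕ.+ K ℕ.+ K))
    ≡ rising ½ K * (½ * (ν * rising (1ℚ + ½ * ν) K)) * (sgn K * rising (1ℚ + - (1ℚ + ½) * ν) K)
  rising½-3K+1 = begin
    rising ½ (suc (K ℕ.+ K ℕ.+ K))                                            ≡⟨ cong (λ n → rising ½ (n ℕ.+ K)) (ℕₚ.+-suc K K) ⟨
    rising ½ (K ℕ.+ suc K ℕ.+ K)                                              ≡⟨ rising-+ ½ (K ℕ.+ suc K) K ⟩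
    rising ½ (K ℕ.+ suc K) * rising (½ + ι (K ℕ.+ suc K)) K                   ≡⟨ cong₂ _*_ first second ⟩
    rising ½ K * (½ * (ν * rising (1ℚ + ½ * ν) K)) * (sgn K * rising (1ℚ + - (1ℚ + ½) * ν) K) ∎
    where
    first : rising ½ (K ℕ.+ suc K) ≡ rising ½ K * (½ * (ν * rising (1ℚ + ½ * ν) K))
    first = subst (λ h → rising h (K ℕ.+ suc K) ≡ rising h K * (½ * (ν * rising (1ℚ + ½ * ν) K))) ½+0ν (rising½-K 0ℚ K)
    base : 1ℚ - (½ + ν) - ι K ≡ 1ℚ + - (1ℚ + ½) * ν
    base = begin
      1ℚ - (½ + ν) - ι K                ≡⟨ ring₁ ν (ι K) ⟩
      1ℚ - ν - ½ * (1ℚ + (ι K + ι K))   ≡⟨ cong (λ x → 1ℚ - ν - ½ * x) ν≡1+2K ⟨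
      1ℚ - ν - ½ * ν                    ≡⟨ ring₂ ν ⟩
      1ℚ + - (1ℚ + ½) * ν               ∎
      where
      ring₁ : ∀ v k → 1ℚ - (½ + v) - k ≡ 1ℚ - v - ½ * (1ℚ + (k + k))
      ring₁ = solve-∀ ℚ-ring
      ring₂ : ∀ v → 1ℚ - v - ½ * v ≡ 1ℚ + - (1ℚ + ½) * v
      ring₂ = solve-∀ ℚ-ring
    second : rising (½ + ι (K ℕ.+ suc K)) K ≡ sgn K * rising (1ℚ + - (1ℚ + ½) * ν) K
    second = trans (cong (λ x → rising (½ + x) K) ι-N)
      (trans (rising-reflect (½ + ν) K) (cong (λ x → sgn K * rising x K) base))

  F-K-K : F K K ≡ ι 3 * sgn K * (ν * (P K * (W * W)))
  F-K-K = begin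
    F K K
      ≡⟨ F-term-cong (sgn (K ℕ.+ K)) R S (ι K) (ι K) e (1/fact- K K) f E
           (trans (sgn-+ K K) (sgn² K)) refl refl refl refl refl (1/fact--refl K) refl refl ⟩
    F-term 1ℚ R S (ι K) (ι K) e 1ℚ f E
      -- The linear factor is 20 K - 2 K + 3 = 6 (½ + 3 K), which completes (½)_{3K} to (½)_{3K+1}.
      -- With the ½ of ν / 2 this produces the constant 3.
      ≡⟨ ring₁ R S (ι K) e f E ⟩
    ι 6 * (S * (½ + (ι K + ι K + ι K))) * (R * e) * e * (f * f) * (E * E)
      ≡⟨ cong₂ (λ x y → ι 6 * x * y * e * (f * f) * (E * E))
           (trans (cong (λ x → S * (½ + x)) (sym (trans (ι-+ (K ℕ.+ K) K) (cong (_+ ι K) (ι-+ K K))))) rising½-3K+1)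
           (rising½*1/rising½ K) ⟩
    ι 6 * (R * (½ * (ν * A)) * (sgn K * B)) * 1ℚ * e * (f * f) * (E * E)
      ≡⟨ ring₂ R ν A (sgn K) B e f E ⟩
    ι 3 * sgn K * (ν * (A * f * (B * f) * (E * E))) * (R * e)
      ≡⟨ cong₂ (λ x y → ι 3 * sgn K * (ν * (A * f * (B * f) * (x * x))) * y) 1/4^K≡X-½*W (rising½*1/rising½ K) ⟩
    ι 3 * sgn K * (ν * (A * f * (B * f) * (X (- ½) K * W * (X (- ½) K * W)))) * 1ℚ
      ≡⟨ ring₃ (ι 3 * sgn K) ν (A * f) (B * f) (X (- ½) K) W ⟩
    ι 3 * sgn K * (ν * (P K * (W * W))) ∎
    where
    R = rising ½ K
    S = rising ½ (K ℕ.+ K ℕ.+ K)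
    e = 1/rising½ K
    f = 1/fact K
    E = 1/4^ K
    A = rising (1ℚ + ½ * ν) K
    B = rising (1ℚ + - (1ℚ + ½) * ν) K
    ring₁ : ∀ R S k e f E →
      1ℚ * R * S * (ι 20 * k - ι 2 * k + ι 3) * (e * e) * 1ℚ * (f * f) * (E * E)
      ≡ ι 6 * (S * (½ + (k + k + k))) * (R * e) * e * (f * f) * (E * E)
    ring₁ = solve-∀ ℚ-ring
    ring₂ : ∀ R v A s B e f E →
      ι 6 * (R * (½ * (v * A)) * (s * B)) * 1ℚ * e * (f * f) * (E * E)
      ≡ ι 3 * s * (v * (A * f * (B * f) * (E * E))) * (R * e)
    ring₂ = solve-∀ ℚ-ring
    ring₃ : ∀ t v a b x w → t * (v * (a * b * (x * w * (x * w)))) * 1ℚ ≡ t * (v * (a * b * (x * x) * (w * w)))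
    ring₃ = solve-∀ ℚ-ring

  Div-F-K-K : Div (r ℕ.+ 2) (F K K - ι 3 * sgn K * ν)
  Div-F-K-K = subst (Div (r ℕ.+ 2)) (sym eq)
    (Div-* (Div-* (Div-ι 3) (Div-sgn K)) (Div-* (Div-π^ r) (Div-* (P≡Q K K≤2K) (Div-* Div-W Div-W))))
    where
    ring₁ : ∀ t v p w → t * (v * (p * (w * w))) - t * v ≡ t * (v * (p * (w * w) - 1ℚ * 1ℚ))
    ring₁ = solve-∀ ℚ-ring
    ring₂ : ∀ t v p x w → t * (v * (p * (w * w) - x * w * (x * w))) ≡ t * (v * ((p - x * x) * (w * w)))
    ring₂ = solve-∀ ℚ-ring
    eq : F K K - ι 3 * sgn K * ν ≡ ι 3 * sgn K * (ν * ((P K - Q K) * (W * W)))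
    eq = begin
      F K K - ι 3 * sgn K * ν                                               ≡⟨ cong (λ x → x - ι 3 * sgn K * ν) F-K-K ⟩
      ι 3 * sgn K * (ν * (P K * (W * W))) - ι 3 * sgn K * ν                 ≡⟨ ring₁ (ι 3 * sgn K) ν (P K) W ⟩
      -- Replacing 1 by `X (- 1ℚ) K * W` pulls W² out and leaves the difference P - Q.
      ι 3 * sgn K * (ν * (P K * (W * W) - 1ℚ * 1ℚ))                         ≡⟨ cong (λ x → ι 3 * sgn K * (ν * (P K * (W * W) - x * x))) X-1*W ⟨
      ι 3 * sgn K * (ν * (P K * (W * W) - X (- 1ℚ) K * W * (X (- 1ℚ) K * W))) ≡⟨ ring₂ (ι 3 * sgn K) ν (P K) (X (- 1ℚ) K) W ⟩
      ι 3 * sgn K * (ν * ((P K - Q K) * (W * W)))                           ∎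

  -- The remaining terms of the telescoped sum

  ∣ᴿ-cong : ∀ {y x x′} → x ≡ x′ → y ∣ᴿ x → y ∣ᴿ x′
  ∣ᴿ-cong {y} eq = subst (y ∣ᴿ_) eq

  rising½-K+1+m-∣ᴿ : ∀ m → m ≤ K ℕ.+ K → fact K * (ν * fact m) ∣ᴿ rising ½ (K ℕ.+ suc m)
  rising½-K+1+m-∣ᴿ m m≤2K = ∣ᴿ-cong (cong (λ x → rising x (K ℕ.+ suc m)) ½+0ν) (rising½-K-∣ᴿ (Div-ι 0) m m≤2K)

  rising½+ν-K+1+m-∣ᴿ : ∀ m → m ≤ K ℕ.+ K → fact K * (ν * fact m) ∣ᴿ rising (½ + ν) (K ℕ.+ suc m)
  rising½+ν-K+1+m-∣ᴿ m m≤2K = ∣ᴿ-cong (cong (λ x → rising (½ + x) (K ℕ.+ suc m)) (*-identityˡ ν)) (rising½-K-∣ᴿ (Div-ι 1) m m≤2K)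

  1/fact--∣ᴿ : ∀ n k l → l ℕ.+ k ≡ K ℕ.+ K → n ≡ k ℕ.+ l → fact k * (1/fact K * 1/fact K) ∣ᴿ 1/fact- n k
  1/fact--∣ᴿ n k l l+k≡2K n≡k+l = ∣ᴿ-cong (trans (sym (1/fact--+ k l)) (cong (λ m → 1/fact- m k) (sym n≡k+l))) (1/fact-∣ᴿ l k l+k≡2K)

  Div-fact*1/fact : Div 0 (fact K * 1/fact K)
  Div-fact*1/fact = subst (Div 0) (sym (fact*1/fact K)) (Div-ι 1)

  -- Of the three factors ν, one from (½)_N and two from (½)_{2N+k}, one supplies p ^ r and the
  -- others supply a p each by absorbing the beta values 1 / (l + 1) and k! l! / K!.
  Div-G : ∀ k l → k ℕ.+ suc l ≡ K → Div (r ℕ.+ 2) (G (suc (K ℕ.+ K)) k)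
  Div-G k l k+1+l≡K = subst (Div (r ℕ.+ 2)) (sym (regroup s R S (ι N) e a (1/fact N) E))
    (Div-∣ᴿ (∣ᴿ-*ˡ (- ι 32 * s * (E * E)) (Div-* (Div-* (Div-neg (Div-ι 32)) (Div-sgn (N ℕ.+ k))) (Div-* (Div-1/4^ N) (Div-1/4^ N)))
      (∣ᴿ-* (∣ᴿ-* (∣ᴿ-* (∣ᴿ-* ∣R ∣S) (∣ᴿ-* ∣e ∣e)) ∣a) (∣ᴿ-* ∣nf ∣nf)))
      (subst (Div (r ℕ.+ 2)) (sym y≡) Div-y))
    where
    N = suc (K ℕ.+ K)
    s = sgn (N ℕ.+ k)
    R = rising ½ N
    S = rising ½ (N ℕ.+ N ℕ.+ k)
    e = 1/rising½ (suc k)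
    a = 1/fact- N (suc k)
    E = 1/4^ N
    f = fact K
    g = 1/fact K
    N≡ : N ≡ K ℕ.+ suc K
    N≡ = sym (ℕₚ.+-suc K K)
    ι-N≡ν : ι N ≡ ν
    ι-N≡ν = cong ι (sym p^r≡1+2K)
    regroup : ∀ s R S n e a f E →
      - ι 32 * s * R * S * (n * n) * (e * e) * a * (f * f) * (E * E)
      ≡ - ι 32 * s * (E * E) * (R * S * (e * e) * a * (n * f * (n * f)))
    regroup = solve-∀ ℚ-ring
    ∣R : f * (ν * f) ∣ᴿ R
    ∣R = ∣ᴿ-cong (cong (rising ½) (sym N≡)) (rising½-K+1+m-∣ᴿ K K≤2K)
    S≡ : R * rising (½ + ν) (K ℕ.+ suc K) * rising (½ + ι 2 * ν) k ≡ S
    S≡ = sym (begin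
      rising ½ (N ℕ.+ N ℕ.+ k)                                         ≡⟨ rising-+ ½ (N ℕ.+ N) k ⟩
      rising ½ (N ℕ.+ N) * rising (½ + ι (N ℕ.+ N)) k                  ≡⟨ cong₂ (λ x y → x * rising (½ + y) k)
          (trans (rising-+ ½ N N) (cong₂ (λ x n → R * rising (½ + x) n) ι-N≡ν N≡))
          (trans (ι-+ N N) (trans (cong (λ x → x + x) ι-N≡ν) (double ν))) ⟩
      R * rising (½ + ν) (K ℕ.+ suc K) * rising (½ + ι 2 * ν) k ∎)
      where
      double : ∀ x → x + x ≡ ι 2 * x
      double = solve-∀ ℚ-ring
    -- Blocks of lengths N, N and k, starting at ½, ½ + ν and ½ + 2 ν; the last has k < K and is too
    -- short to contain a multiple of ν / 2.
    ∣S : f * (ν * f) * (f * (ν * f)) * (f * 1/fact (suc l)) ∣ᴿ S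
    ∣S = ∣ᴿ-cong S≡ (∣ᴿ-* (∣ᴿ-* ∣R (rising½+ν-K+1+m-∣ᴿ K K≤2K)) (rising½-∣ᴿ (Div-ι 2) k (suc l) k+1+l≡K))
    1+k+l≡K : suc k ℕ.+ l ≡ K
    1+k+l≡K = trans (sym (ℕₚ.+-suc k l)) k+1+l≡K
    ∣e : fact l * g ∣ᴿ e
    ∣e = 1/rising½-∣ᴿ (suc k) l 1+k+l≡K
    2K≡ : suc l ℕ.+ K ℕ.+ k ≡ K ℕ.+ K
    2K≡ = trans (perm (suc l) K k) (cong (K ℕ.+_) k+1+l≡K)
      where
      perm : ∀ a b c → a ℕ.+ b ℕ.+ c ≡ b ℕ.+ (c ℕ.+ a)
      perm = ℕ-Solver.solve-∀
    ∣a : fact k * (g * g) ∣ᴿ a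
    ∣a = 1/fact--∣ᴿ (K ℕ.+ K) k (suc l ℕ.+ K) 2K≡ (trans (sym 2K≡) (ℕₚ.+-comm (suc l ℕ.+ K) k))
    -- The factor n² of G turns 1 / N!² into 1 / (2K)!², so that no N is left in the denominator.
    ∣nf : 1ℚ * (g * g) ∣ᴿ ι N * 1/fact N
    ∣nf = ∣ᴿ-cong (sym (trans (cong (_* 1/fact N) (ι-suc (K ℕ.+ K)))
      (trans (*-comm (1ℚ + ι (K ℕ.+ K)) (1/fact N)) (sym (1/fact-suc (K ℕ.+ K))))))
      (1/fact-∣ᴿ (K ℕ.+ K) 0 (ℕₚ.+-identityʳ (K ℕ.+ K)))
    β₁ β₂ : ℚ
    β₁ = fact l * 1ℚ * 1/fact (suc l)
    β₂ = fact k * fact l * g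
    y≡ : f * (ν * f) * (f * (ν * f) * (f * (ν * f)) * (f * 1/fact (suc l))) * (fact l * g * (fact l * g)) * (fact k * (g * g)) * (1ℚ * (g * g) * (1ℚ * (g * g)))
       ≡ ν * (ν * β₁ * (ν * β₂)) * (f * g * (f * g) * (f * g) * (f * g) * (f * g) * (f * g) * (f * g))
    y≡ = ring f ν (1/fact (suc l)) (fact l) (fact k) g
      where
      ring : ∀ f v h l k g →
        f * (v * f) * (f * (v * f) * (f * (v * f)) * (f * h)) * (l * g * (l * g)) * (k * (g * g)) * (1ℚ * (g * g) * (1ℚ * (g * g)))
        ≡ v * (v * (l * 1ℚ * h) * (v * (k * l * g))) * (f * g * (f * g) * (f * g) * (f * g) * (f * g) * (f * g) * (f * g))
      ring = solve-∀ ℚ-ring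
    Div-β₁ : Div 1 (ν * β₁)
    Div-β₁ = subst (λ n → Div 1 (ν * (fact l * 1ℚ * 1/fact (suc n)))) (ℕₚ.+-identityʳ l)
      (Div-ν*beta 0 l (subst (λ n → suc n ≤ K ℕ.+ K) (sym (ℕₚ.+-identityʳ l))
        (ℕₚ.≤-trans (subst (suc l ≤_) k+1+l≡K (ℕₚ.m≤n+m (suc l) k)) K≤2K)))
    Div-β₂ : Div 1 (ν * β₂)
    Div-β₂ = subst (λ n → Div 1 (ν * (fact k * fact l * 1/fact n))) 1+k+l≡K
      (Div-ν*beta l k (subst (_≤ K ℕ.+ K) (sym 1+k+l≡K) K≤2K))
    Div-y : Div (r ℕ.+ 2) (ν * (ν * β₁ * (ν * β₂)) * (f * g * (f * g) * (f * g) * (f * g) * (f * g) * (f * g) * (f * g)))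
    Div-y = Div-*ʳ (Div-* (Div-π^ r) (Div-* Div-β₁ Div-β₂))
      (Div-* (Div-* (Div-* (Div-* (Div-* (Div-* u u) u) u) u) u) u)
      where u = Div-fact*1/fact

  -- Again three factors ν: (½)ₙ brings ν m!, and (½)_{2n+K} brings ν K! and ν (2m)!. Both beta
  -- values equal m! l! / K!, and what remains is the Catalan number of index m.
  Div-F : ∀ m l → suc m ℕ.+ l ≡ K → Div (r ℕ.+ 2) (F (suc K ℕ.+ m) K)
  Div-F m l 1+m+l≡K = subst (Div (r ℕ.+ 2)) (sym (regroup s R S (ι n) (ι K) e a (1/fact n) E))
    (Div-∣ᴿ (∣ᴿ-*ˡ (s * (ι 20 * ι n - ι 2 * ι K + ι 3) * (E * E))
        (Div-* (Div-* (Div-sgn (n ℕ.+ K)) (Div-+ (Div-- (Div-* (Div-ι 20) (Div-ι n)) (Div-* (Div-ι 2) (Div-ι K))) (Div-ι 3)))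
               (Div-* (Div-1/4^ n) (Div-1/4^ n)))
      (∣ᴿ-* (∣ᴿ-* (∣ᴿ-* (∣ᴿ-* ∣R ∣S) (∣ᴿ-* ∣e ∣e)) (∣ᴿ-refl a)) (∣ᴿ-* ∣f ∣f)))
      (subst (Div (r ℕ.+ 2)) (sym y≡) Div-y))
    where
    n = suc K ℕ.+ m
    s = sgn (n ℕ.+ K)
    R = rising ½ n
    S = rising ½ (n ℕ.+ n ℕ.+ K)
    e = 1/rising½ K
    a = 1/fact- n K
    E = 1/4^ n
    f = fact K
    g = 1/fact K
    h = 1/fact (suc m)
    n≡ : n ≡ K ℕ.+ suc m
    n≡ = sym (ℕₚ.+-suc K m)
    regroup : ∀ s R S n k e a f E →
      s * R * S * (ι 20 * n - ι 2 * k + ι 3) * (e * e) * a * (f * f) * (E * E)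
      ≡ s * (ι 20 * n - ι 2 * k + ι 3) * (E * E) * (R * S * (e * e) * a * (f * f))
    regroup = solve-∀ ℚ-ring
    m≤K : m ≤ K
    m≤K = subst (m ≤_) 1+m+l≡K (ℕₚ.≤-trans (ℕₚ.m≤m+n m l) (ℕₚ.n≤1+n _))
    ∣R : f * (ν * fact m) ∣ᴿ R
    ∣R = ∣ᴿ-cong (cong (rising ½) (sym n≡)) (rising½-K+1+m-∣ᴿ m (ℕₚ.≤-trans m≤K K≤2K))
    -- 2n + K = N + (K + 1 + 2m): the second block, starting at ½ + ν, runs 2m steps past 3 ν / 2.
    S≡ : rising ½ (K ℕ.+ suc K) * rising (½ + ν) (K ℕ.+ suc (m ℕ.+ m)) ≡ S
    S≡ = sym (begin
      rising ½ (n ℕ.+ n ℕ.+ K)                                                        ≡⟨ cong (rising ½) (perm K m) ⟩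
      rising ½ (K ℕ.+ suc K ℕ.+ (K ℕ.+ suc (m ℕ.+ m)))                                ≡⟨ rising-+ ½ (K ℕ.+ suc K) (K ℕ.+ suc (m ℕ.+ m)) ⟩
      rising ½ (K ℕ.+ suc K) * rising (½ + ι (K ℕ.+ suc K)) (K ℕ.+ suc (m ℕ.+ m))     ≡⟨ cong (λ x → rising ½ (K ℕ.+ suc K) * rising (½ + x) (K ℕ.+ suc (m ℕ.+ m))) ι-N ⟩
      rising ½ (K ℕ.+ suc K) * rising (½ + ν) (K ℕ.+ suc (m ℕ.+ m))                   ∎)
      where
      perm : ∀ k m → suc k ℕ.+ m ℕ.+ (suc k ℕ.+ m) ℕ.+ k ≡ k ℕ.+ suc k ℕ.+ (k ℕ.+ suc (m ℕ.+ m))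
      perm = ℕ-Solver.solve-∀
    ∣S : f * (ν * f) * (f * (ν * fact (m ℕ.+ m))) ∣ᴿ S
    ∣S = ∣ᴿ-cong S≡ (∣ᴿ-* (rising½-K+1+m-∣ᴿ K K≤2K) (rising½+ν-K+1+m-∣ᴿ (m ℕ.+ m) (ℕₚ.+-mono-≤ m≤K m≤K)))
    ∣e : 1ℚ * g ∣ᴿ e
    ∣e = 1/rising½-∣ᴿ K 0 (ℕₚ.+-identityʳ K)
    a≡ : a ≡ h
    a≡ = trans (cong (λ x → 1/fact- x K) n≡) (1/fact--+ K (suc m))
    ∣f : fact l * (g * g) ∣ᴿ 1/fact n
    ∣f = 1/fact-∣ᴿ n l (trans (perm K m l) (cong (K ℕ.+_) 1+m+l≡K))
      where
      perm : ∀ k m l → suc k ℕ.+ m ℕ.+ l ≡ k ℕ.+ (suc m ℕ.+ l)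
      perm = ℕ-Solver.solve-∀
    β : ℚ
    β = fact m * fact l * g
    y≡ : f * (ν * fact m) * (f * (ν * f) * (f * (ν * fact (m ℕ.+ m)))) * (1ℚ * g * (1ℚ * g)) * a * (fact l * (g * g) * (fact l * (g * g)))
       ≡ ν * (ν * β * (ν * β)) * (catalan m * (f * g * (f * g) * (f * g) * (f * g)))
    y≡ = begin
      f * (ν * fact m) * (f * (ν * f) * (f * (ν * fact (m ℕ.+ m)))) * (1ℚ * g * (1ℚ * g)) * a * (fact l * (g * g) * (fact l * (g * g)))
        ≡⟨ cong (λ x → f * (ν * fact m) * (f * (ν * f) * (f * (ν * fact (m ℕ.+ m)))) * (1ℚ * g * (1ℚ * g)) * x * (fact l * (g * g) * (fact l * (g * g)))) a≡ ⟩
      f * (ν * fact m) * (f * (ν * f) * (f * (ν * fact (m ℕ.+ m)))) * (1ℚ * g * (1ℚ * g)) * h * (fact l * (g * g) * (fact l * (g * g)))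
        ≡⟨ ring₁ f ν (fact m) (fact (m ℕ.+ m)) (fact l) g h ⟩
      ν * (ν * ν) * fact m * (fact l * fact l) * (fact (m ℕ.+ m) * h) * (g * g) * (f * g * (f * g) * (f * g) * (f * g)) * 1ℚ
        -- Only one m! is available. Inserting m! / m! provides the second one for β² and completes
        -- (2m)! / (m + 1)! to the Catalan number.
        ≡⟨ cong (λ x → ν * (ν * ν) * fact m * (fact l * fact l) * (fact (m ℕ.+ m) * h) * (g * g) * (f * g * (f * g) * (f * g) * (f * g)) * x) (fact*1/fact m) ⟨
      ν * (ν * ν) * fact m * (fact l * fact l) * (fact (m ℕ.+ m) * h) * (g * g) * (f * g * (f * g) * (f * g) * (f * g)) * (fact m * 1/fact m)
        ≡⟨ ring₂ ν (fact m) (fact l) (fact (m ℕ.+ m)) h g (1/fact m) (f * g * (f * g) * (f * g) * (f * g)) ⟩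
      ν * (ν * β * (ν * β)) * (catalan m * (f * g * (f * g) * (f * g) * (f * g))) ∎
      where
      ring₁ : ∀ f v m d l g h →
        f * (v * m) * (f * (v * f) * (f * (v * d))) * (1ℚ * g * (1ℚ * g)) * h * (l * (g * g) * (l * (g * g)))
        ≡ v * (v * v) * m * (l * l) * (d * h) * (g * g) * (f * g * (f * g) * (f * g) * (f * g)) * 1ℚ
      ring₁ = solve-∀ ℚ-ring
      ring₂ : ∀ v m l d h g i u →
        v * (v * v) * m * (l * l) * (d * h) * (g * g) * u * (m * i)
        ≡ v * (v * (m * l * g) * (v * (m * l * g))) * (d * (i * h) * u)
      ring₂ = solve-∀ ℚ-ring
    Div-β : Div 1 (ν * β)
    Div-β = subst (λ x → Div 1 (ν * (fact m * fact l * 1/fact x))) 1+m+l≡K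
      (Div-ν*beta l m (subst (_≤ K ℕ.+ K) (sym 1+m+l≡K) K≤2K))
    Div-y : Div (r ℕ.+ 2) (ν * (ν * β * (ν * β)) * (catalan m * (f * g * (f * g) * (f * g) * (f * g))))
    Div-y = Div-*ʳ (Div-* (Div-π^ r) (Div-* Div-β Div-β))
      (Div-* (Div-catalan m) (Div-* (Div-* (Div-* u u) u) u))
      where u = Div-fact*1/fact

  Div-Σ< : ∀ {m} n {f} → (∀ i → i < n → Div m (f i)) → Div m (Σ< n f)
  Div-Σ< zero    Df = Div-0
  Div-Σ< (suc n) Df = Div-+ (Div-Σ< n (λ i i<n → Df i (ℕₚ.m<n⇒m<1+n i<n))) (Df n (ℕₚ.n<1+n n))

  <⇒+ : ∀ {k} → k < K → ∃ λ l → suc k ℕ.+ l ≡ K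
  <⇒+ {k} k<K = K ℕ.∸ suc k , ℕₚ.m+[n∸m]≡n k<K

  Div-∑summand : Div (r ℕ.+ 2) ((∑[ n < p ℕ.^ r ] summand (toℕ n)) - ι 3 * sgn K * ν)
  Div-∑summand = subst (Div (r ℕ.+ 2)) (sym eq)
    (Div-+ Div-F-K-K (Div-+
      (Div-Σ< K (λ m m<K → Div-F m (proj₁ (<⇒+ m<K)) (proj₂ (<⇒+ m<K))))
      (Div-Σ< K (λ k k<K → Div-G k (proj₁ (<⇒+ k<K)) (trans (ℕₚ.+-suc k _) (proj₂ (<⇒+ k<K)))))))
    where
    Φ Γ : ℚ
    Φ = Σ< K (λ m → F (suc K ℕ.+ m) K)
    Γ = Σ< K (G (suc (K ℕ.+ K)))
    ring : ∀ a b c → a + b - c ≡ a - c + b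
    ring = solve-∀ ℚ-ring
    eq : (∑[ n < p ℕ.^ r ] summand (toℕ n)) - ι 3 * sgn K * ν ≡ F K K - ι 3 * sgn K * ν + (Φ + Γ)
    eq = trans (cong (λ x → x - ι 3 * sgn K * ν)
      (trans (cong (λ N → ∑[ n < N ] summand (toℕ n)) p^r≡1+2K) (summand-Σ K)))
      (ring (F K K) (Φ + Γ) (ι 3 * sgn K * ν))

-- Powers of odd primes, and the passage to the valuation

odd-^ : ∀ {p} → 2 ∤ p → ∀ r → ∃ λ K → p ℕ.^ r ≡ suc (K ℕ.+ K)
odd-^ {p} 2∤p r = K , (begin
    p ℕ.^ r                              ≡⟨ m≡m%n+[m/n]*n (p ℕ.^ r) 2 ⟩
    p ℕ.^ r ℕ.% 2 ℕ.+ K ℕ.* 2            ≡⟨ cong (ℕ._+ K ℕ.* 2) (rem (p ℕ.^ r ℕ.% 2) refl (m%n<n (p ℕ.^ r) 2)) ⟩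
    suc (K ℕ.* 2)                        ≡⟨ cong suc (double K) ⟩
    suc (K ℕ.+ K)                        ∎)
  where
  open Localization 2 prime[2] using (p∤1; p∤*)
  K = p ℕ.^ r ℕ./ 2
  double : ∀ k → k ℕ.* 2 ≡ k ℕ.+ k
  double = ℕ-Solver.solve-∀
  2∤^ : ∀ r → 2 ∤ p ℕ.^ r
  2∤^ zero    = p∤1
  2∤^ (suc r) = p∤* p (p ℕ.^ r) 2∤p (2∤^ r)
  rem : ∀ b → p ℕ.^ r ℕ.% 2 ≡ b → b < 2 → b ≡ 1
  rem 0 eq _ = ⊥-elim (2∤^ r (m%n≡0⇒n∣m (p ℕ.^ r) 2 eq))
  rem 1 _ _ = refl
  rem (suc (suc _)) _ (s≤s (s≤s ()))

theorem1p3 : (p r : ℕ) → Prime p → 2 ∤ p → 1 ℕ.≤ r →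
    (∑[ n < p ℕ.^ r ] summand (toℕ n))
    ≋ ((+ 3) ℤ.* (-1ℤ ℤ.^ ((p ℕ.^ r ℕ.∸ 1) ℕ./ 2)) ℤ.* (+ (p ℕ.^ r))) / 1
    [mod p ^ (r ℕ.+ 2) ]
theorem1p3 p r p-prime 2∤p _ = Div⇒≤⁺valuation
    (subst (λ x → Div (r ℕ.+ 2) ((∑[ n < p ℕ.^ r ] summand (toℕ n)) - x)) rhs Div-∑summand)
  where
  K = proj₁ (odd-^ 2∤p r)
  p^r≡1+2K : p ℕ.^ r ≡ suc (K ℕ.+ K)
  p^r≡1+2K = proj₂ (odd-^ 2∤p r)
  open Localization p p-prime
  open Estimates p p-prime 2∤p r K p^r≡1+2K
  half : (p ℕ.^ r ℕ.∸ 1) ℕ./ 2 ≡ K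
  half = trans (cong (λ N → (N ℕ.∸ 1) ℕ./ 2) p^r≡1+2K) (trans (cong (ℕ._/ 2) (double K)) (m*n/n≡m K 2))
    where
    double : ∀ k → k ℕ.+ k ≡ k ℕ.* 2
    double = ℕ-Solver.solve-∀
  rhs : ι 3 * sgn K * π^ r ≡ ⟦ + 3 ℤ.* (-1ℤ ℤ.^ ((p ℕ.^ r ℕ.∸ 1) ℕ./ 2)) ℤ.* + (p ℕ.^ r) ⟧
  rhs = sym (begin
    ⟦ + 3 ℤ.* (-1ℤ ℤ.^ ((p ℕ.^ r ℕ.∸ 1) ℕ./ 2)) ℤ.* + (p ℕ.^ r) ⟧  ≡⟨ cong (λ k → ⟦ + 3 ℤ.* (-1ℤ ℤ.^ k) ℤ.* + (p ℕ.^ r) ⟧) half ⟩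
    ⟦ + 3 ℤ.* (-1ℤ ℤ.^ K) ℤ.* + (p ℕ.^ r) ⟧                        ≡⟨ ⟦⟧-* (+ 3 ℤ.* (-1ℤ ℤ.^ K)) (+ (p ℕ.^ r)) ⟩
    ⟦ + 3 ℤ.* (-1ℤ ℤ.^ K) ⟧ * π^ r                                 ≡⟨ cong (_* π^ r) (trans (⟦⟧-* (+ 3) (-1ℤ ℤ.^ K)) (cong (ι 3 *_) (⟦-1^⟧≡sgn K))) ⟩
    ι 3 * sgn K * π^ r ∎)
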